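{- Let $u$ be a packed word of length $n$. Then $$\mathbf N_u*\Theta_n=\sum_{v\ge u}(-1)^{\max(v)-\max(u)}\,t^{f(u,v)}\prod_{k=1}^{\max(u)}\big(1-t^{g(u,v,k)}\big)\,\mathbf N_v,$$ i.e. this is $\mathbf N_u((1-t)A)$ expressed in the basis $\mathbf N_v(A)$.
   Context: Packed word: word over positive integers whose set of letters is $\{1,\dots,r\}$; $\max(u)$ its maximal letter; $\mathrm{ev}(u)=(|u|_1,\dots,|u|_{\max(u)})$ its evaluation (a composition). $\mathbf{WQSym}^*_n$ is the vector space with basis $(\mathbf N_u)$ indexed by packed words of length $n$, with internal product $\mathbf N_u*\mathbf N_v=\mathbf N_{\mathrm{pack}(u,v)}$, where $\mathrm{pack}(u,v)$ replaces each biletter $(u_i,v_i)$ by its rank among the distinct biletters $\{(u_j,v_j)\}$ ordered lexicographically. For a composition $J$ of $n$ set $S^J=\sum_{\mathrm{ev}(w)=J}\mathbf N_w$. Let $\Theta_n=\sum_{k=0}^n(-t)^k\sum_{I\vDash k}(-1)^{k-\ell(I)}S^{I\cdot(n-k)}$, where $I\cdot(n-k)$ is the concatenation of $I$ with the part $n-k$ (omitted if $n-k=0$), $\ell(I)$ the number of parts, and $I$ ranges over compositions of $k$ (the empty one if $k=0$); $\Theta_n$ is the degree-$n$ part of $\sigma_1((1-t)A)=\lambda_{ -t}(A)\sigma_1(A)$, and $\mathbf N_u((1-t)A):=\mathbf N_u*\Theta_n$. A packed word $v$ is finer than $u$, written $v\ge u$, if $u=\varphi(v)$ letterwise for some nondecreasing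 map $\varphi$ of the positive integers. Then each letter $k$ of $u$ has preimage a block of $q_k$ consecutive letters of $v$; write $\mathrm{ev}(u)=(i_1,\dots,i_p)$ and let $i_k^{(1)},\dots,i_k^{(q_k)}$ be the multiplicities in $v$ of the letters of the $k$-th block, in increasing order. Then $f(u,v)=\sum_{k=1}^p\sum_{j=1}^{q_k-1}i_k^{(j)}$ and $g(u,v,k)=i_k^{(q_k)}$. -}

module Defs where

open import Data.Bool using (Bool; true; false; _∧_; _∨_; if_then_else_; not)
open import Data.Nat using (ℕ; zero; suc; _+_; _∸_; _≤_; _⊔_; _≡ᵇ_; _<ᵇ_)
open import Data.Integer as ℤ using (ℤ; +_; -_)
open import Data.List using (List; []; _∷_; map; length; concatMap; upTo; _++_; zip; foldr)
open import Data.Nat.ListAction using (sum)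
open import Data.List.Membership.Propositional using (_∈_)
open import Data.Product using (_×_; _,_; Σ)
open import Relation.Binary.PropositionalEquality using (_≡_)

-- Words are lists of natural numbers (letters are positive integers).

Word : Set
Word = List ℕ

filterᵇ : {A : Set} → (A → Bool) → List A → List A
filterᵇ p [] = []
filterᵇ p (x ∷ xs) = if p x then x ∷ filterᵇ p xs else filterᵇ p xs

anyᵇ : {A : Set} → (A → Bool) → List A → Bool
anyᵇ p [] = false
anyᵇ p (x ∷ xs) = p x ∨ anyᵇ p xs

oneTo : ℕ → List ℕ
oneTo p = map suc (upTo p)

maxL : Word → ℕ
maxL = foldr _⊔_ 0

count : ℕ → Word → ℕ
count a w = length (filterᵇ (λ b → a ≡ᵇ b) w)

ev : Word → List ℕ
ev w = map (λ a → count a w) (oneTo (maxL w))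

Packed : Word → Set
Packed w = ((a : ℕ) → a ∈ w → 1 ≤ a) × ((a : ℕ) → 1 ≤ a → a ≤ maxL w → a ∈ w)

eqWord : Word → Word → Bool
eqWord [] [] = true
eqWord [] (_ ∷ _) = false
eqWord (_ ∷ _) [] = false
eqWord (a ∷ u) (b ∷ v) = (a ≡ᵇ b) ∧ eqWord u v

eqPair : ℕ × ℕ → ℕ × ℕ → Bool
eqPair (a , b) (c , d) = (a ≡ᵇ c) ∧ (b ≡ᵇ d)

lexLt : ℕ × ℕ → ℕ × ℕ → Bool
lexLt (a , b) (c , d) = (a <ᵇ c) ∨ ((a ≡ᵇ c) ∧ (b <ᵇ d))

dedupPairs : List (ℕ × ℕ) → List (ℕ × ℕ)
dedupPairs [] = []
dedupPairs (x ∷ xs) = x ∷ filterᵇ (λ y → not (eqPair x y)) (dedupPairs xs)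

pack : Word → Word → Word
pack u v = map (λ p → suc (length (filterᵇ (λ q → lexLt q p) ds))) bs
  where
    bs = zip u v
    ds = dedupPairs bs

comps : ℕ → List (List ℕ)
comps k = go k k
  where
    -- go fuel k : compositions of k, fuel ≥ k
    go : ℕ → ℕ → List (List ℕ)
    go _ zero = [] ∷ []
    go zero (suc _) = []
    go (suc f) (suc k) =
      concatMap (λ i → map (λ I → suc i ∷ I) (go f (k ∸ i))) (upTo (suc k))

wordsOver : List ℕ → ℕ → List Word
wordsOver as zero = [] ∷ []
wordsOver as (suc n) = concatMap (λ a → map (a ∷_) (wordsOver as n)) as

wordsEv : List ℕ → List Word
wordsEv J = filterᵇ (λ w → eqWord (ev w) J) (wordsOver (oneTo (length J)) (sum J))

sign : ℕ → ℤ
sign zero = + 1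
sign (suc k) = - sign k

-- A term  c · t^e · N_w  of an element of WQSym* ⊗ ℤ[t]; elements are
-- finite formal sums (lists) of such terms.
Term : Set
Term = ℤ × ℕ × Word

coeff : List Term → Word → ℕ → ℤ
coeff [] v m = + 0
coeff ((c , e , w) ∷ ts) v m =
  if (e ≡ᵇ m) ∧ eqWord w v then c ℤ.+ coeff ts v m else coeff ts v m

-- I·(n-k): the part n-k is omitted when it is 0
lastPart : ℕ → List ℕ
lastPart zero = []
lastPart (suc r) = suc r ∷ []

-- Θ_n = Σ_k (-t)^k Σ_{I ⊨ k} (-1)^{k-ℓ(I)} S^{I·(n-k)},  S^J = Σ_{ev(w)=J} N_w
Theta : ℕ → List Term
Theta n =
  concatMap (λ k →
    concatMap (λ I →
      map (λ w → (sign k ℤ.* sign (k ∸ length I) , k , w))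
          (wordsEv (I ++ lastPart (n ∸ k))))
      (comps k))
    (upTo (suc n))

-- N_u * X  (internal product, extended ℤ[t]-linearly in X)
starN : Word → List Term → List Term
starN u = map (λ { (c , e , w) → (c , e , pack u w) })

-- Polynomials in t with integer coefficients, as formal sums of c·t^e

Poly : Set
Poly = List (ℤ × ℕ)

polyCoeff : Poly → ℕ → ℤ
polyCoeff [] m = + 0
polyCoeff ((c , e) ∷ p) m = if e ≡ᵇ m then c ℤ.+ polyCoeff p m else polyCoeff p m

polyMul : Poly → Poly → Poly
polyMul p q = concatMap (λ { (c , e) → map (λ { (d , f) → (c ℤ.* d , e + f) }) q }) p

polyProd : List Poly → Poly
polyProd = foldr polyMul ((+ 1 , 0) ∷ [])

Finer : Word → Word → Set
Finer v u = Packed v × Σ (ℕ → ℕ) (λ φ →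
  ((a b : ℕ) → a ≤ b → φ a ≤ φ b) × map φ v ≡ u)

-- letters of v in the k-th block (preimage of the letter k of u), increasing
blockLetters : Word → Word → ℕ → List ℕ
blockLetters u v k =
  filterᵇ (λ a → anyᵇ (λ p → eqPair p (k , a)) (zip u v)) (oneTo (maxL v))

blockMults : Word → Word → ℕ → List ℕ
blockMults u v k = map (λ a → count a v) (blockLetters u v k)

initL : List ℕ → List ℕ
initL [] = []
initL (x ∷ []) = []
initL (x ∷ y ∷ xs) = x ∷ initL (y ∷ xs)

lastL : List ℕ → ℕ
lastL [] = 0
lastL (x ∷ []) = x
lastL (x ∷ y ∷ xs) = lastL (y ∷ xs)

fUV : Word → Word → ℕ
fUV u v = sum (map (λ k → sum (initL (blockMults u v k))) (oneTo (maxL u)))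

gUV : Word → Word → ℕ → ℕ
gUV u v k = lastL (blockMults u v k)

rhsPoly : Word → Word → Poly
rhsPoly u v =
  polyMul ((sign (maxL v ∸ maxL u) , fUV u v) ∷ [])
          (polyProd (map (λ k → (+ 1 , 0) ∷ (- (+ 1) , gUV u v k) ∷ []) (oneTo (maxL u))))

{-# OPTIONS --safe #-}
module Submission where

-- The last part of I·(n − k) counts the positions of an infinite letter that
-- may be absent: Θ_n is the signed sum, over ℓ, of the words w over {1,…,ℓ,∞} in
-- which every finite letter occurs, with sign (−1)^ℓ and weight t per finite
-- position.  If v refines u through φ, then pack u w = v iff w = ψ ∘ v for
-- some ψ on the letters of v that is strictly increasing on every block
-- φ⁻¹(k).  Build ψ one letter at a time, from the last letter of v to the
-- first.  A new letter a that must stay below the finite or infinite value y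
-- either reuses one of the y − 1 smaller values or opens one of y gaps, the
-- latter with a change of sign; so its finite choices contribute −t^{|v|_a}
-- in total, whatever the values already chosen.  The last letter of a block is
-- unconstrained and has the extra choice ∞, of weight 1, which gives it the
-- factor 1 − t^{|v|_a}.  The product of these factors is the right-hand side.

open import Defs
open import Data.Bool using (Bool; true; false; if_then_else_; T; not; _∧_)
open import Data.Bool.Properties using (T?; T-∧; T-∨)
open import Data.Empty using (⊥-elim)
open import Data.Integer using (ℤ; +_; -_; 0ℤ; 1ℤ) renaming (_+_ to _+ᶻ_; _*_ to _*ᶻ_)
import Data.Integer.Properties as ℤₚ
open import Data.Integer.Tactic.RingSolver using (solve-∀)
open import Data.List using (List; []; _∷_; map; length; concatMap; upTo; applyUpTo; _++_; _∷ʳ_; filter; zip)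
open import Data.List.Membership.Propositional using (_∈_; _∉_)
open import Data.List.Membership.Propositional.Properties
import Data.List.Properties as Listₚ
open import Data.List.Relation.Binary.Subset.Propositional using (_⊆_)
open import Data.List.Relation.Unary.All as All using (All; []; _∷_)
import Data.List.Relation.Unary.All.Properties as Allₚ
open import Data.List.Relation.Unary.AllPairs as AllPairs using (AllPairs; []; _∷_)
import Data.List.Relation.Unary.AllPairs.Properties as AllPairsₚ
open import Data.List.Relation.Unary.Any using (here; there)
open import Data.List.Relation.Unary.Linked using (Linked; []; [-]; _∷_)
import Data.List.Relation.Unary.Linked.Properties as Linkedₚ
open import Data.List.Relation.Unary.Unique.Propositional using (Unique)
import Data.List.Relation.Unary.Unique.Propositional.Properties as Uniqueₚ
open import Data.Nat as ℕ using (ℕ; zero; suc; _+_; _∸_; _≤_; _<_; _<?_; _≟_; z≤n; s≤s; _<ᵇ_; _≡ᵇ_)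
open import Data.Nat.ListAction using (sum)
import Data.Nat.Properties as ℕₚ
open import Data.List.Membership.DecPropositional _≟_ using (_∈?_; _∉?_)
open import Data.Nat.Tactic.RingSolver using () renaming (solve-∀ to ℕ-solve-∀)
open import Data.Product using (_×_; _,_; proj₁; proj₂; ∃)
open import Data.Sum using (_⊎_; inj₁; inj₂)
open import Data.Unit using (⊤; tt)
open import Function using (_∘_; id; case_of_)
open import Function.Bundles using (Equivalence)
open import Relation.Binary.Definitions using (DecidableEquality; tri<; tri≈; tri>)
open import Relation.Binary.PropositionalEquality hiding (J)
open import Relation.Nullary using (¬_; Dec; yes; no; does; ¬?; _×-dec_)

-- Polynomials in t are tested against an arbitrary `h : ℕ → ℤ`, read as the linear functional
-- sending t^e to `h e`. Multiplication by t^i becomes the translation `h (i + e)`, so formal sums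
-- are never normalised, and the coefficient of t^m is recovered by taking for `h` the indicator of
-- m. The obstacle is that the number of reusable values depends on the values already chosen, so no
-- single ℓ yields a product. Only the alternating sum over ℓ does: the surplus at ℓ cancels against
-- part of the fresh values at ℓ + 1. Cutting the sum off leaves one boundary term, which dies once
-- ℓ exceeds the number of letters. Going from the last letter to the first makes the constraint on
-- a new value depend on the head of the word alone. Infinity is encoded as ℓ + 1, so that words
-- over one finite alphabet suffice and comparison with infinity is ordinary comparison.

private
  variable
    A B : Set
    P Q : Set

-- Finite sums and indicators

∑ : List A → (A → ℤ) → ℤ
∑ []       f = 0ℤ
∑ (x ∷ xs) f = f x +ᶻ ∑ xs f

∑-cong : (xs : List A) {f g : A → ℤ} → (∀ x → x ∈ xs → f x ≡ g x) → ∑ xs f ≡ ∑ xs g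
∑-cong []       eq = refl
∑-cong (x ∷ xs) eq = cong₂ _+ᶻ_ (eq x (here refl)) (∑-cong xs λ y y∈ → eq y (there y∈))

∑-zero : (xs : List A) {f : A → ℤ} → (∀ x → x ∈ xs → f x ≡ 0ℤ) → ∑ xs f ≡ 0ℤ
∑-zero []       eq = refl
∑-zero (x ∷ xs) eq =
  cong₂ _+ᶻ_ (eq x (here refl)) (∑-zero xs λ y y∈ → eq y (there y∈))

∑-+ : (xs : List A) (f g : A → ℤ) → ∑ xs (λ x → f x +ᶻ g x) ≡ ∑ xs f +ᶻ ∑ xs g
∑-+ []       f g = refl
∑-+ (x ∷ xs) f g = trans (cong ((f x +ᶻ g x) +ᶻ_) (∑-+ xs f g)) (lemma (f x) (g x) _ _)
  where
  lemma : ∀ a b c d → (a +ᶻ b) +ᶻ (c +ᶻ d) ≡ (a +ᶻ c) +ᶻ (b +ᶻ d)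
  lemma = solve-∀

∑-*ˡ : (c : ℤ) (xs : List A) (f : A → ℤ) → ∑ xs (λ x → c *ᶻ f x) ≡ c *ᶻ ∑ xs f
∑-*ˡ c []       f = sym (ℤₚ.*-zeroʳ c)
∑-*ˡ c (x ∷ xs) f =
  trans (cong (c *ᶻ f x +ᶻ_) (∑-*ˡ c xs f)) (sym (ℤₚ.*-distribˡ-+ c (f x) (∑ xs f)))

∑-*ʳ : (xs : List A) (f : A → ℤ) (c : ℤ) → ∑ xs (λ x → f x *ᶻ c) ≡ ∑ xs f *ᶻ c
∑-*ʳ []       f c = refl
∑-*ʳ (x ∷ xs) f c =
  trans (cong (f x *ᶻ c +ᶻ_) (∑-*ʳ xs f c)) (sym (ℤₚ.*-distribʳ-+ c (f x) (∑ xs f)))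

∑-++ : (xs ys : List A) (f : A → ℤ) → ∑ (xs ++ ys) f ≡ ∑ xs f +ᶻ ∑ ys f
∑-++ []       ys f = sym (ℤₚ.+-identityˡ _)
∑-++ (x ∷ xs) ys f =
  trans (cong (f x +ᶻ_) (∑-++ xs ys f)) (sym (ℤₚ.+-assoc (f x) (∑ xs f) (∑ ys f)))

∑-∷ʳ : (xs : List A) (x : A) (f : A → ℤ) → ∑ (xs ∷ʳ x) f ≡ ∑ xs f +ᶻ f x
∑-∷ʳ xs x f = trans (∑-++ xs (x ∷ []) f) (cong (∑ xs f +ᶻ_) (ℤₚ.+-identityʳ (f x)))

∑-map : (h : A → B) (xs : List A) (f : B → ℤ) → ∑ (map h xs) f ≡ ∑ xs (f ∘ h)
∑-map h []       f = refl
∑-map h (x ∷ xs) f = cong (f (h x) +ᶻ_) (∑-map h xs f)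

∑-concatMap : (h : A → List B) (xs : List A) (f : B → ℤ) →
  ∑ (concatMap h xs) f ≡ ∑ xs (λ x → ∑ (h x) f)
∑-concatMap h []       f = refl
∑-concatMap h (x ∷ xs) f =
  trans (∑-++ (h x) _ f) (cong (∑ (h x) f +ᶻ_) (∑-concatMap h xs f))

∑-swap : (xs : List A) (ys : List B) (f : A → B → ℤ) →
  ∑ xs (λ x → ∑ ys (f x)) ≡ ∑ ys (λ y → ∑ xs (λ x → f x y))
∑-swap []       ys f = sym (∑-zero ys λ _ _ → refl)
∑-swap (x ∷ xs) ys f =
  trans (cong (∑ ys (f x) +ᶻ_) (∑-swap xs ys f)) (sym (∑-+ ys (f x) _))

⟦_⟧ : Bool → ℤ
⟦ b ⟧ = if b then 1ℤ else 0ℤ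

𝟙 : Dec P → ℤ
𝟙 P? = ⟦ does P? ⟧

𝟙-yes : (P? : Dec P) → P → 𝟙 P? ≡ 1ℤ
𝟙-yes (yes _) p = refl
𝟙-yes (no ¬p) p = ⊥-elim (¬p p)

𝟙-no : (P? : Dec P) → ¬ P → 𝟙 P? ≡ 0ℤ
𝟙-no (yes p) ¬p = ⊥-elim (¬p p)
𝟙-no (no _)  ¬p = refl

𝟙-cong : (P? : Dec P) (Q? : Dec Q) → (P → Q) → (Q → P) → 𝟙 P? ≡ 𝟙 Q?
𝟙-cong (yes p) Q? f g = sym (𝟙-yes Q? (f p))
𝟙-cong (no ¬p) Q? f g = sym (𝟙-no Q? (¬p ∘ g))

𝟙-× : (P? : Dec P) (Q? : Dec Q) → 𝟙 (P? ×-dec Q?) ≡ 𝟙 P? *ᶻ 𝟙 Q?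
𝟙-× (yes _) Q? = sym (ℤₚ.*-identityˡ _)
𝟙-× (no _)  Q? = refl

-- Reindexing below mostly goes through such deltas: one is inserted, the sums are exchanged, and
-- the other sum collapses. Bijections then need no rearrangement of lists.
∑-δ : (_≟_ : DecidableEquality A) {xs : List A} {x : A} → Unique xs → x ∈ xs →
  (f : A → ℤ) → ∑ xs (λ y → 𝟙 (y ≟ x) *ᶻ f y) ≡ f x
∑-δ _≟_ {x ∷ xs} (x∉ ∷ !xs) (here refl) f = trans
  (cong₂ _+ᶻ_
    (trans (cong (_*ᶻ f x) (𝟙-yes (x ≟ x) refl)) (ℤₚ.*-identityˡ (f x)))
    (∑-zero xs λ y y∈ → cong (_*ᶻ f y) (𝟙-no (y ≟ x) λ { refl → All.lookup x∉ y∈ refl })))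
  (ℤₚ.+-identityʳ (f x))
∑-δ _≟_ {y ∷ xs} (y∉ ∷ !xs) (there x∈) f = trans
  (cong₂ _+ᶻ_ (cong (_*ᶻ f y) (𝟙-no (y ≟ _) λ { refl → All.lookup y∉ x∈ refl }))
    (∑-δ _≟_ !xs x∈ f))
  (ℤₚ.+-identityˡ _)

∑-filterᵇ : (p : A → Bool) (xs : List A) (f : A → ℤ) →
  ∑ (filterᵇ p xs) f ≡ ∑ xs (λ x → ⟦ p x ⟧ *ᶻ f x)
∑-filterᵇ p []       f = refl
∑-filterᵇ p (x ∷ xs) f with p x
... | true  = cong₂ _+ᶻ_ (sym (ℤₚ.*-identityˡ (f x))) (∑-filterᵇ p xs f)
... | false = trans (∑-filterᵇ p xs f) (sym (ℤₚ.+-identityˡ _))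

-- Intervals and words

upTo-suc : ∀ n → upTo (suc n) ≡ 0 ∷ oneTo n
upTo-suc n = cong (0 ∷_) (sym (Listₚ.map-upTo suc n))

oneTo-suc : ∀ n → oneTo (suc n) ≡ 1 ∷ map suc (oneTo n)
oneTo-suc n = cong (map suc) (upTo-suc n)

oneTo-∷ʳ : ∀ n → oneTo (suc n) ≡ oneTo n ∷ʳ suc n
oneTo-∷ʳ n = trans (cong (map suc) (sym (Listₚ.upTo-∷ʳ n))) (Listₚ.map-++ suc (upTo n) (n ∷ []))

∑-upTo-last : ∀ n f → ∑ (upTo (suc n)) f ≡ ∑ (upTo n) f +ᶻ f n
∑-upTo-last n f = trans (cong (λ ns → ∑ ns f) (sym (Listₚ.upTo-∷ʳ n))) (∑-∷ʳ (upTo n) n f)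

∑-upTo-head : ∀ n f → ∑ (upTo (suc n)) f ≡ f 0 +ᶻ ∑ (upTo n) (f ∘ suc)
∑-upTo-head n f =
  trans (cong (λ ns → ∑ ns f) (upTo-suc n)) (cong (f 0 +ᶻ_) (∑-map suc (upTo n) f))

∑-oneTo-last : ∀ n f → ∑ (oneTo (suc n)) f ≡ ∑ (oneTo n) f +ᶻ f (suc n)
∑-oneTo-last n f = trans (cong (λ ns → ∑ ns f) (oneTo-∷ʳ n)) (∑-∷ʳ (oneTo n) (suc n) f)

∑-oneTo-head : ∀ n f → ∑ (oneTo (suc n)) f ≡ f 1 +ᶻ ∑ (oneTo n) (f ∘ suc)
∑-oneTo-head n f =
  trans (cong (λ ns → ∑ ns f) (oneTo-suc n)) (cong (f 1 +ᶻ_) (∑-map suc (oneTo n) f))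

∈-oneTo⁺ : ∀ {n a} → 1 ≤ a → a ≤ n → a ∈ oneTo n
∈-oneTo⁺ (s≤s z≤n) a≤n = ∈-map⁺ suc (∈-upTo⁺ a≤n)

∈-oneTo⁻ : ∀ {n a} → a ∈ oneTo n → 1 ≤ a × a ≤ n
∈-oneTo⁻ a∈ with _ , i∈ , refl ← ∈-map⁻ suc a∈ = s≤s z≤n , ∈-upTo⁻ i∈

oneTo-unique : ∀ n → Unique (oneTo n)
oneTo-unique n = Uniqueₚ.map⁺ ℕₚ.suc-injective (Uniqueₚ.upTo⁺ n)

length-oneTo : ∀ n → length (oneTo n) ≡ n
length-oneTo n = trans (Listₚ.length-map suc (upTo n)) (Listₚ.length-upTo n)

-- Pigeonhole: delete from `ys` one occurrence of the head of `xs`; the tail, which avoids the head,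
-- still embeds in what is left.
Unique⊆⇒length≤ : {xs ys : List A} → Unique xs → xs ⊆ ys → length xs ≤ length ys
Unique⊆⇒length≤ {xs = []} _ _ = z≤n
Unique⊆⇒length≤ {A} {xs = x ∷ xs} (x∉ ∷ !xs) xs⊆ with ∈-∃++ (xs⊆ (here refl))
... | ys , zs , refl = subst (suc (length xs) ≤_)
    (trans (cong suc (Listₚ.length-++ ys))
      (trans (sym (ℕₚ.+-suc (length ys) (length zs))) (sym (Listₚ.length-++ ys))))
    (s≤s (Unique⊆⇒length≤ !xs drop))
  where
  drop : xs ⊆ ys ++ zs
  drop y∈ with ∈-++⁻ ys (xs⊆ (there y∈))
  ... | inj₁ y∈ys         = ∈-++⁺ˡ y∈ys
  ... | inj₂ (here refl)  = ⊥-elim (All.lookup x∉ y∈ refl)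
  ... | inj₂ (there y∈zs) = ∈-++⁺ʳ ys y∈zs

-- Words over an initial interval of letters, and surjectivity

words : ℕ → ℕ → List Word
words A n = wordsOver (oneTo A) n

infix 4 _≟ʷ_
_≟ʷ_ : DecidableEquality Word
_≟ʷ_ = Listₚ.≡-dec _≟_

∑-wordsOver : ∀ as n (f : Word → ℤ) →
  ∑ (wordsOver as (suc n)) f ≡ ∑ as (λ a → ∑ (wordsOver as n) (λ w → f (a ∷ w)))
∑-wordsOver as n f = trans (∑-concatMap _ as f)
  (∑-cong as λ a _ → ∑-map (a ∷_) (wordsOver as n) f)

∈-wordsOver⁻ : ∀ as n {w} → w ∈ wordsOver as n → length w ≡ n × w ⊆ as
∈-wordsOver⁻ as zero    (here refl) = refl , λ ()
∈-wordsOver⁻ as (suc n) w∈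
  with ws , w∈ws , ws∈ ← ∈-concat⁻′ (map (λ a → map (a ∷_) (wordsOver as n)) as) w∈
  with a , a∈ , refl ← ∈-map⁻ (λ a → map (a ∷_) (wordsOver as n)) ws∈
  with w′ , w′∈ , refl ← ∈-map⁻ (a ∷_) w∈ws
  with refl , w′⊆ ← ∈-wordsOver⁻ as n w′∈
  = refl , λ { (here refl) → a∈ ; (there b∈) → w′⊆ b∈ }

∑-words-δ : ∀ A {n w₀} → length w₀ ≡ n → w₀ ⊆ oneTo A → (f : Word → ℤ) →
  ∑ (words A n) (λ w → 𝟙 (w ≟ʷ w₀) *ᶻ f w) ≡ f w₀
∑-words-δ A {w₀ = []}     refl w₀⊆ f = trans (ℤₚ.+-identityʳ _) (ℤₚ.*-identityˡ _)
∑-words-δ A {w₀ = b ∷ w₀} refl w₀⊆ f = begin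
  ∑ (words A (suc (length w₀))) (λ w → 𝟙 (w ≟ʷ (b ∷ w₀)) *ᶻ f w)
    ≡⟨ ∑-wordsOver (oneTo A) (length w₀) _ ⟩
  ∑ (oneTo A) (λ a → ∑ (words A (length w₀)) (λ w → 𝟙 ((a ∷ w) ≟ʷ (b ∷ w₀)) *ᶻ f (a ∷ w)))
    ≡⟨ ∑-cong (oneTo A) (λ a _ → trans
         (∑-cong (words A (length w₀)) λ w _ → trans
           (cong (_*ᶻ f (a ∷ w)) (trans
             (𝟙-cong ((a ∷ w) ≟ʷ (b ∷ w₀)) ((a ≟ b) ×-dec (w ≟ʷ w₀))
               (λ { refl → refl , refl }) (λ { (refl , refl) → refl }))
             (𝟙-× (a ≟ b) (w ≟ʷ w₀))))
           (ℤₚ.*-assoc (𝟙 (a ≟ b)) (𝟙 (w ≟ʷ w₀)) (f (a ∷ w))))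
         (∑-*ˡ (𝟙 (a ≟ b)) (words A (length w₀)) _)) ⟩
  ∑ (oneTo A) (λ a → 𝟙 (a ≟ b) *ᶻ ∑ (words A (length w₀)) (λ w → 𝟙 (w ≟ʷ w₀) *ᶻ f (a ∷ w)))
    ≡⟨ ∑-δ _≟_ (oneTo-unique A) (w₀⊆ (here refl)) _ ⟩
  ∑ (words A (length w₀)) (λ w → 𝟙 (w ≟ʷ w₀) *ᶻ f (b ∷ w))
    ≡⟨ ∑-words-δ A refl (w₀⊆ ∘ there) (λ w → f (b ∷ w)) ⟩
  f (b ∷ w₀) ∎
  where open ≡-Reasoning

Surj : ℕ → Word → Set
Surj ℓ w = All (_∈ w) (oneTo ℓ)

surj? : ∀ ℓ w → Dec (Surj ℓ w)
surj? ℓ w = All.all? (_∈? w) (oneTo ℓ)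

Surj⁻ : ∀ {ℓ w} → Surj ℓ w → ∀ {a} → 1 ≤ a → a ≤ ℓ → a ∈ w
Surj⁻ s 1≤a a≤ℓ = All.lookup s (∈-oneTo⁺ 1≤a a≤ℓ)

Surj⁺ : ∀ {ℓ w} → (∀ {a} → 1 ≤ a → a ≤ ℓ → a ∈ w) → Surj ℓ w
Surj⁺ f = All.tabulate λ a∈ → f (proj₁ (∈-oneTo⁻ a∈)) (proj₂ (∈-oneTo⁻ a∈))

Surj⇒≤ : ∀ {ℓ w} → Surj ℓ w → ℓ ≤ length w
Surj⇒≤ {ℓ} {w} s =
  subst (_≤ length w) (length-oneTo ℓ) (Unique⊆⇒length≤ (oneTo-unique ℓ) (All.lookup s))

-- The increasing map that leaves room for a fresh letter x.
shift : ℕ → ℕ → ℕ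
shift x b = if b <ᵇ x then b else suc b

shift-< : ∀ {x b} → b < x → shift x b ≡ b
shift-< {x} {b} b<x with b <ᵇ x | ℕₚ.<⇒<ᵇ b<x
... | true | _ = refl

shift-≥ : ∀ {x b} → x ≤ b → shift x b ≡ suc b
shift-≥ {x} {b} x≤b with b <ᵇ x in eq
... | false = refl
... | true  = ⊥-elim (ℕₚ.<⇒≱ (ℕₚ.<ᵇ⇒< b x (subst T (sym eq) tt)) x≤b)

shift-≢ : ∀ x b → shift x b ≢ x
shift-≢ x b eq with ℕₚ.<-≤-connex b x
... | inj₁ b<x = ℕₚ.<⇒≢ b<x (trans (sym (shift-< b<x)) eq)
... | inj₂ x≤b = ℕₚ.<⇒≢ (s≤s x≤b) (trans (sym eq) (shift-≥ x≤b))

shift-mono-< : ∀ x {a b} → a < b → shift x a < shift x b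
shift-mono-< x {a} {b} a<b with ℕₚ.<-≤-connex a x | ℕₚ.<-≤-connex b x
... | inj₁ a<x | inj₁ b<x rewrite shift-< a<x | shift-< b<x = a<b
... | inj₁ a<x | inj₂ x≤b rewrite shift-< a<x | shift-≥ x≤b = ℕₚ.m<n⇒m<1+n a<b
... | inj₂ x≤a | inj₁ b<x = ⊥-elim (ℕₚ.<-asym a<b (ℕₚ.<-≤-trans b<x x≤a))
... | inj₂ x≤a | inj₂ x≤b rewrite shift-≥ x≤a | shift-≥ x≤b = s≤s a<b

shift-cancel-< : ∀ x {a b} → shift x a < shift x b → a < b
shift-cancel-< x {a} {b} lt with ℕₚ.<-cmp a b
... | tri< a<b _ _ = a<b
... | tri≈ _ refl _ = ⊥-elim (ℕₚ.<-irrefl refl lt)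
... | tri> _ _ b<a = ⊥-elim (ℕₚ.<-asym lt (shift-mono-< x b<a))

shift-injective : ∀ x {a b} → shift x a ≡ shift x b → a ≡ b
shift-injective x {a} {b} eq with ℕₚ.<-cmp a b
... | tri< a<b _ _ = ⊥-elim (ℕₚ.<⇒≢ (shift-mono-< x a<b) eq)
... | tri≈ _ a≡b _ = a≡b
... | tri> _ _ b<a = ⊥-elim (ℕₚ.<⇒≢ (shift-mono-< x b<a) (sym eq))

-- `shift x` is the increasing bijection from 1..A onto 1..A+1 without x. Induction on A removes the
-- top letter: either it is x, and then the shift moves nothing, or it is the shifted image of A.
∑-shift : ∀ {A x} → 1 ≤ x → x ≤ suc A → (f : ℕ → ℤ) →
  ∑ (oneTo (suc A)) (λ a → 𝟙 (¬? (a ≟ x)) *ᶻ f a) ≡ ∑ (oneTo A) (f ∘ shift x)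
∑-shift {A} {x} 1≤x x≤ f with ℕₚ.m≤n⇒m<n∨m≡n x≤
∑-shift {A} {x} 1≤x x≤ f | inj₂ refl = begin
  ∑ (oneTo (suc A)) (λ a → 𝟙 (¬? (a ≟ x)) *ᶻ f a)
    ≡⟨ ∑-oneTo-last A _ ⟩
  ∑ (oneTo A) (λ a → 𝟙 (¬? (a ≟ x)) *ᶻ f a) +ᶻ 𝟙 (¬? (x ≟ x)) *ᶻ f x
    ≡⟨ cong₂ _+ᶻ_
         (∑-cong (oneTo A) λ a a∈ →
           let a<x = s≤s (proj₂ (∈-oneTo⁻ a∈)) in trans
           (cong (_*ᶻ f a) (𝟙-yes (¬? (a ≟ x)) (ℕₚ.<⇒≢ a<x)))
           (trans (ℤₚ.*-identityˡ (f a)) (cong f (sym (shift-< a<x)))))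
         (cong (_*ᶻ f x) (𝟙-no (¬? (x ≟ x)) (λ ¬eq → ¬eq refl))) ⟩
  ∑ (oneTo A) (f ∘ shift x) +ᶻ 0ℤ
    ≡⟨ ℤₚ.+-identityʳ _ ⟩
  ∑ (oneTo A) (f ∘ shift x) ∎
  where open ≡-Reasoning
∑-shift {zero}  1≤x x≤ f | inj₁ (s≤s x≤0) = ⊥-elim (ℕₚ.<⇒≱ 1≤x x≤0)
∑-shift {suc A} {x} 1≤x x≤ f | inj₁ (s≤s x≤A) = begin
  ∑ (oneTo (suc (suc A))) (λ a → 𝟙 (¬? (a ≟ x)) *ᶻ f a)
    ≡⟨ ∑-oneTo-last (suc A) (λ a → 𝟙 (¬? (a ≟ x)) *ᶻ f a) ⟩
  ∑ (oneTo (suc A)) (λ a → 𝟙 (¬? (a ≟ x)) *ᶻ f a) +ᶻ 𝟙 (¬? (suc (suc A) ≟ x)) *ᶻ f (suc (suc A))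
    ≡⟨ cong₂ _+ᶻ_ (∑-shift 1≤x x≤A f) (trans
         (cong (_*ᶻ f (suc (suc A)))
           (𝟙-yes (¬? (suc (suc A) ≟ x)) (≢-sym (ℕₚ.<⇒≢ (s≤s x≤A)))))
         (trans (ℤₚ.*-identityˡ _) (cong f (sym (shift-≥ x≤A))))) ⟩
  ∑ (oneTo A) (f ∘ shift x) +ᶻ f (shift x (suc A))
    ≡⟨ ∑-oneTo-last A (f ∘ shift x) ⟨
  ∑ (oneTo (suc A)) (f ∘ shift x) ∎
  where open ≡-Reasoning

∑-words-shift : ∀ {A x} → 1 ≤ x → x ≤ suc A → ∀ n (f : Word → ℤ) →
  ∑ (words (suc A) n) (λ w → 𝟙 (x ∉? w) *ᶻ f w) ≡ ∑ (words A n) (f ∘ map (shift x))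
∑-words-shift 1≤x x≤ zero f = cong (_+ᶻ 0ℤ) (ℤₚ.*-identityˡ (f []))
∑-words-shift {A} {x} 1≤x x≤ (suc n) f = begin
  ∑ (words (suc A) (suc n)) (λ w → 𝟙 (x ∉? w) *ᶻ f w)
    ≡⟨ ∑-wordsOver (oneTo (suc A)) n _ ⟩
  ∑ (oneTo (suc A)) (λ a → ∑ (words (suc A) n) (λ w → 𝟙 (x ∉? (a ∷ w)) *ᶻ f (a ∷ w)))
    ≡⟨ ∑-cong (oneTo (suc A)) (λ a _ → trans
         (∑-cong (words (suc A) n) λ w _ → trans
           (cong (_*ᶻ f (a ∷ w)) (trans
             (𝟙-cong (x ∉? (a ∷ w)) (¬? (a ≟ x) ×-dec (x ∉? w))
               (λ x∉ → (λ { refl → x∉ (here refl) }) , x∉ ∘ there)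
               (λ { (a≢x , x∉) (here refl) → a≢x refl ; (a≢x , x∉) (there x∈) → x∉ x∈ }))
             (𝟙-× (¬? (a ≟ x)) (x ∉? w))))
           (ℤₚ.*-assoc (𝟙 (¬? (a ≟ x))) (𝟙 (x ∉? w)) (f (a ∷ w))))
         (∑-*ˡ (𝟙 (¬? (a ≟ x))) (words (suc A) n) _)) ⟩
  ∑ (oneTo (suc A)) (λ a → 𝟙 (¬? (a ≟ x)) *ᶻ
      ∑ (words (suc A) n) (λ w → 𝟙 (x ∉? w) *ᶻ f (a ∷ w)))
    ≡⟨ ∑-shift 1≤x x≤ _ ⟩
  ∑ (oneTo A) (λ a → ∑ (words (suc A) n) (λ w → 𝟙 (x ∉? w) *ᶻ f (shift x a ∷ w)))
    ≡⟨ ∑-cong (oneTo A) (λ a _ → ∑-words-shift 1≤x x≤ n (λ w → f (shift x a ∷ w))) ⟩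
  ∑ (oneTo A) (λ a → ∑ (words A n) (λ w → f (shift x a ∷ map (shift x) w)))
    ≡⟨ ∑-wordsOver (oneTo A) n _ ⟨
  ∑ (words A (suc n)) (f ∘ map (shift x)) ∎
  where open ≡-Reasoning

-- Insertion of letters, with multiplicities

Below : Bool → ℕ → ℕ → Set
Below true  x y = x < y
Below false x y = ⊤

below? : ∀ b x y → Dec (Below b x y)
below? true  x y = x <? y
below? false x y = yes tt

-- In `Ok` the default is the infinite value ℓ + 1: at the end of the word the constraint `true`
-- still excludes infinity, and counting choices needs no separate case there.
headOr : ℕ → Word → ℕ
headOr d []      = d
headOr d (x ∷ _) = x

-- A pair (b , i) describes a letter of multiplicity i, where b says whether
-- the next letter lies in the same block.  Words ψ over {1,…,ℓ+1} assign a
-- value to each letter; the value ℓ+1 is "infinite", it need not be taken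
-- and its letters carry no weight.

Ok : ℕ → List (Bool × ℕ) → Word → Set
Ok ℓ []            ψ       = ⊤
Ok ℓ (_ ∷ _)       []      = ⊤
Ok ℓ ((b , i) ∷ D) (x ∷ ψ) = Below b x (headOr (suc ℓ) ψ) × Ok ℓ D ψ

ok? : ∀ ℓ D ψ → Dec (Ok ℓ D ψ)
ok? ℓ []            ψ       = yes tt
ok? ℓ (_ ∷ _)       []      = yes tt
ok? ℓ ((b , i) ∷ D) (x ∷ ψ) = below? b x (headOr (suc ℓ) ψ) ×-dec ok? ℓ D ψ

cost : ℕ → ℕ → ℕ → ℕ
cost ℓ i x = if x ≡ᵇ suc ℓ then 0 else i

weight : ℕ → List (Bool × ℕ) → Word → ℕ
weight ℓ []            ψ       = 0
weight ℓ (_ ∷ _)       []      = 0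
weight ℓ ((b , i) ∷ D) (x ∷ ψ) = cost ℓ i x + weight ℓ D ψ

value : ℕ → List (Bool × ℕ) → (ℕ → ℤ) → Word → ℤ
value ℓ D h ψ = 𝟙 (surj? ℓ ψ) *ᶻ (𝟙 (ok? ℓ D ψ) *ᶻ h (weight ℓ D ψ))

-- The cut-off L is a parameter because prepending a letter relates L + 1 to L. Levels ℓ above
-- `length D` contribute nothing, since ψ has too few positions to contain ℓ distinct values.
signedSum : List (Bool × ℕ) → ℕ → (ℕ → ℤ) → ℤ
signedSum D L h = ∑ (upTo L) λ ℓ → sign ℓ *ᶻ ∑ (words (suc ℓ) (length D)) (value ℓ D h)

-- The linear functional t^e ↦ h e applied to the product over D of the
-- factors −t^i (for b = true) and 1 − t^i (for b = false).
blockProduct : List (Bool × ℕ) → (ℕ → ℤ) → ℤ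
blockProduct []            h = h 0
blockProduct ((b , i) ∷ D) h =
  ⟦ not b ⟧ *ᶻ blockProduct D h +ᶻ - blockProduct D (λ e → h (i + e))

cost-∞ : ∀ ℓ i → cost ℓ i (suc ℓ) ≡ 0
cost-∞ ℓ i with suc ℓ ≡ᵇ suc ℓ | ℕₚ.≡⇒≡ᵇ (suc ℓ) (suc ℓ) refl
... | true | _ = refl

cost-≢ : ∀ {ℓ x} i → x ≢ suc ℓ → cost ℓ i x ≡ i
cost-≢ {ℓ} {x} i x≢ with x ≡ᵇ suc ℓ in eq
... | false = refl
... | true  = ⊥-elim (x≢ (ℕₚ.≡ᵇ⇒≡ x (suc ℓ) (subst T (sym eq) tt)))

headOr-bounds : ∀ {ℓ ψ} → ψ ⊆ oneTo (suc ℓ) → 1 ≤ headOr (suc ℓ) ψ × headOr (suc ℓ) ψ ≤ suc ℓ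
headOr-bounds {ψ = []}    ψ⊆ = s≤s z≤n , ℕₚ.≤-refl
headOr-bounds {ψ = _ ∷ _} ψ⊆ = ∈-oneTo⁻ (ψ⊆ (here refl))

headOr-shift : ∀ x d ψ → headOr (shift x d) (map (shift x) ψ) ≡ shift x (headOr d ψ)
headOr-shift x d []      = refl
headOr-shift x d (_ ∷ _) = refl

Below-shift⁺ : ∀ b x {y z} → Below b y z → Below b (shift x y) (shift x z)
Below-shift⁺ true  x = shift-mono-< x
Below-shift⁺ false x = id

Below-shift⁻ : ∀ b x {y z} → Below b (shift x y) (shift x z) → Below b y z
Below-shift⁻ true  x = shift-cancel-< x
Below-shift⁻ false x = id

module _ {ℓ x : ℕ} (1≤x : 1 ≤ x) (x≤ : x ≤ suc ℓ) where

  -- The default moves along with the word: as x ≤ ℓ + 1, the shift carries the old infinity ℓ + 1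
  -- to the new infinity ℓ + 2.
  headOr-shift′ : ∀ ψ → headOr (suc (suc ℓ)) (map (shift x) ψ) ≡ shift x (headOr (suc ℓ) ψ)
  headOr-shift′ ψ =
    trans (cong (λ d → headOr d (map (shift x) ψ)) (sym (shift-≥ x≤))) (headOr-shift x (suc ℓ) ψ)

  Ok-shift⁺ : ∀ D ψ → Ok ℓ D ψ → Ok (suc ℓ) D (map (shift x) ψ)
  Ok-shift⁺ []            ψ       o       = tt
  Ok-shift⁺ (_ ∷ _)       []      o       = tt
  Ok-shift⁺ ((b , i) ∷ D) (y ∷ ψ) (l , o) =
    subst (Below b (shift x y)) (sym (headOr-shift′ ψ)) (Below-shift⁺ b x l) , Ok-shift⁺ D ψ o

  Ok-shift⁻ : ∀ D ψ → Ok (suc ℓ) D (map (shift x) ψ) → Ok ℓ D ψ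
  Ok-shift⁻ []            ψ       o       = tt
  Ok-shift⁻ (_ ∷ _)       []      o       = tt
  Ok-shift⁻ ((b , i) ∷ D) (y ∷ ψ) (l , o) =
    Below-shift⁻ b x (subst (Below b (shift x y)) (headOr-shift′ ψ) l) , Ok-shift⁻ D ψ o

  cost-shift : ∀ i y → cost (suc ℓ) i (shift x y) ≡ cost ℓ i y
  cost-shift i y with y ≟ suc ℓ
  ... | yes refl = trans (cong (cost (suc ℓ) i) (shift-≥ x≤))
                     (trans (cost-∞ (suc ℓ) i) (sym (cost-∞ ℓ i)))
  ... | no  y≢   = trans
    (cost-≢ i λ eq → y≢ (shift-injective x (trans eq (sym (shift-≥ x≤))))) (sym (cost-≢ i y≢))

  weight-shift : ∀ D ψ → weight (suc ℓ) D (map (shift x) ψ) ≡ weight ℓ D ψ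
  weight-shift []            ψ       = refl
  weight-shift (_ ∷ _)       []      = refl
  weight-shift ((b , i) ∷ D) (y ∷ ψ) = cong₂ _+_ (cost-shift i y) (weight-shift D ψ)

  Surj-shift⁺ : ∀ {ψ} → Surj ℓ ψ → Surj (suc ℓ) (x ∷ map (shift x) ψ)
  Surj-shift⁺ {ψ} s = Surj⁺ hit
    where
    hit : ∀ {a} → 1 ≤ a → a ≤ suc ℓ → a ∈ x ∷ map (shift x) ψ
    hit {a} 1≤a a≤ with ℕₚ.<-cmp a x
    ... | tri≈ _ a≡x _ = here a≡x
    ... | tri< a<x _ _ = there (subst (_∈ map (shift x) ψ) (shift-< a<x)
          (∈-map⁺ (shift x) (Surj⁻ s 1≤a (ℕₚ.≤-pred (ℕₚ.≤-trans a<x x≤)))))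
    hit {suc a} 1≤a (s≤s a≤) | tri> _ _ (s≤s x≤a) = there (subst (_∈ map (shift x) ψ) (shift-≥ x≤a)
          (∈-map⁺ (shift x) (Surj⁻ s (ℕₚ.≤-trans 1≤x x≤a) a≤)))

  Surj-shift⁻ : ∀ {ψ} → Surj (suc ℓ) (x ∷ map (shift x) ψ) → Surj ℓ ψ
  Surj-shift⁻ {ψ} s = Surj⁺ hit
    where
    shift-bounds : ∀ {a} → 1 ≤ a → a ≤ ℓ → 1 ≤ shift x a × shift x a ≤ suc ℓ
    shift-bounds {a} 1≤a a≤ with ℕₚ.<-≤-connex a x
    ... | inj₁ a<x rewrite shift-< a<x = 1≤a , ℕₚ.m≤n⇒m≤1+n a≤
    ... | inj₂ x≤a rewrite shift-≥ x≤a = s≤s z≤n , s≤s a≤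
    hit : ∀ {a} → 1 ≤ a → a ≤ ℓ → a ∈ ψ
    hit {a} 1≤a a≤ with shift-bounds 1≤a a≤
    ... | 1≤ , ≤suc with Surj⁻ s 1≤ ≤suc
    ... | here eq = ⊥-elim (shift-≢ x a eq)
    ... | there p with _ , b∈ , eq ← ∈-map⁻ (shift x) p =
      subst (_∈ ψ) (sym (shift-injective x eq)) b∈

-- Prepending one letter: the recursion for the alternating sum

module InsertLetter (b : Bool) (i : ℕ) (D : List (Bool × ℕ)) (h : ℕ → ℤ) where

  private
    M : ℕ
    M = length D

    h′ : ℕ → ℤ
    h′ e = h (i + e)

    D⁺ : List (Bool × ℕ)
    D⁺ = (b , i) ∷ D

  -- The number of finite values allowed in front of ψ. It is never computed: all that matters is
  -- that a fresh value has exactly one more choice.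
  choices : ℕ → Word → ℤ
  choices ℓ ψ = ∑ (oneTo ℓ) λ x → 𝟙 (below? b x (headOr (suc ℓ) ψ))

  private
    -- The surjectivity factor is left as c because it has two readings: for a reused x it is
    -- surjectivity of ψ at the same level, for a fresh x that of the word with the gap at x closed,
    -- one level lower. The weight i of x is absorbed in `h′`.
    value-∷ : ∀ {ℓ x} ψ → x ≢ suc ℓ → (c : ℤ) → 𝟙 (surj? ℓ (x ∷ ψ)) ≡ c →
      value ℓ D⁺ h (x ∷ ψ) ≡
        𝟙 (below? b x (headOr (suc ℓ) ψ)) *ᶻ (c *ᶻ (𝟙 (ok? ℓ D ψ) *ᶻ h′ (weight ℓ D ψ)))
    value-∷ {ℓ} {x} ψ x≢ c refl
      rewrite cost-≢ {ℓ} {x} i x≢ | 𝟙-× (below? b x (headOr (suc ℓ) ψ)) (ok? ℓ D ψ) =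
      lemma (𝟙 (surj? ℓ (x ∷ ψ))) (𝟙 (below? b x (headOr (suc ℓ) ψ))) (𝟙 (ok? ℓ D ψ)) _
      where
      lemma : ∀ s l o v → s *ᶻ ((l *ᶻ o) *ᶻ v) ≡ l *ᶻ (s *ᶻ (o *ᶻ v))
      lemma = solve-∀

  private
    Surj-tail : ∀ {ℓ ψ} → Surj ℓ (suc ℓ ∷ ψ) → Surj ℓ ψ
    Surj-tail s = Surj⁺ λ 1≤a a≤ → case Surj⁻ s 1≤a a≤ of λ
      { (here refl) → ⊥-elim (ℕₚ.1+n≰n a≤) ; (there a∈) → a∈ }

    below-∞ : ∀ b {ℓ y} → y ≤ suc ℓ → 𝟙 (below? b (suc ℓ) y) ≡ ⟦ not b ⟧
    below-∞ true  {ℓ} {y} y≤ = 𝟙-no (suc ℓ <? y) (ℕₚ.≤⇒≯ y≤)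
    below-∞ false         y≤ = refl

  -- An infinite letter carries no weight and hits no finite value. No value of the alphabet exceeds
  -- it, so a strict constraint forbids it; hence the factor `⟦ not b ⟧`.
  value-∞ : ∀ {ℓ ψ} → ψ ⊆ oneTo (suc ℓ) → value ℓ D⁺ h (suc ℓ ∷ ψ) ≡ ⟦ not b ⟧ *ᶻ value ℓ D h ψ
  value-∞ {ℓ} {ψ} ψ⊆
    rewrite cost-∞ ℓ i | 𝟙-× (below? b (suc ℓ) (headOr (suc ℓ) ψ)) (ok? ℓ D ψ)
          | 𝟙-cong (surj? ℓ (suc ℓ ∷ ψ)) (surj? ℓ ψ) Surj-tail (All.map there)
          | below-∞ b (proj₂ (headOr-bounds ψ⊆)) =
    lemma (𝟙 (surj? ℓ ψ)) ⟦ not b ⟧ (𝟙 (ok? ℓ D ψ)) _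
    where
    lemma : ∀ s l o v → s *ᶻ ((l *ᶻ o) *ᶻ v) ≡ l *ᶻ (s *ᶻ (o *ᶻ v))
    lemma = solve-∀

  -- Exactly one summand can survive: if x occurs in ψ the second indicator is 0, and if it does
  -- not, ψ misses a finite value, so the first term vanishes.
  value-split : ∀ {ℓ x} ψ → x ∈ oneTo ℓ → value ℓ D⁺ h (x ∷ ψ) ≡
    𝟙 (below? b x (headOr (suc ℓ) ψ)) *ᶻ value ℓ D h′ ψ +ᶻ 𝟙 (x ∉? ψ) *ᶻ value ℓ D⁺ h (x ∷ ψ)
  value-split {ℓ} {x} ψ x∈ with ∈-oneTo⁻ x∈ | x ∈? ψ
  ... | 1≤x , x≤ | yes x∈ψ = trans
    (value-∷ ψ (ℕₚ.<⇒≢ (s≤s x≤)) _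
      (𝟙-cong (surj? ℓ (x ∷ ψ)) (surj? ℓ ψ)
        (All.map λ { (here refl) → x∈ψ ; (there a∈) → a∈ }) (All.map there)))
    (sym (ℤₚ.+-identityʳ _))
  ... | 1≤x , x≤ | no x∉ψ
    rewrite 𝟙-no (surj? ℓ ψ) (λ s → x∉ψ (Surj⁻ s 1≤x x≤)) =
    lemma (𝟙 (below? b x (headOr (suc ℓ) ψ))) _
    where
    lemma : ∀ l v → v ≡ l *ᶻ 0ℤ +ᶻ 1ℤ *ᶻ v
    lemma = solve-∀

  -- The shift respects order, infinity and weights, and the fresh x fills the only gap in the set
  -- of values. So only the constraint on x itself remains visible.
  value-shift : ∀ {ℓ x} ψ → 1 ≤ x → x ≤ suc ℓ → value (suc ℓ) D⁺ h (x ∷ map (shift x) ψ) ≡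
    𝟙 (below? b x (shift x (headOr (suc ℓ) ψ))) *ᶻ value ℓ D h′ ψ
  value-shift {ℓ} {x} ψ 1≤x x≤ = trans
    (value-∷ (map (shift x) ψ) (ℕₚ.<⇒≢ (s≤s x≤)) _
      (𝟙-cong (surj? (suc ℓ) (x ∷ map (shift x) ψ)) (surj? ℓ ψ)
        (Surj-shift⁻ 1≤x x≤) (Surj-shift⁺ 1≤x x≤)))
    (cong₂ _*ᶻ_
      (cong (λ y → 𝟙 (below? b x y)) (headOr-shift′ 1≤x x≤ ψ))
      (cong (𝟙 (surj? ℓ ψ) *ᶻ_) (cong₂ _*ᶻ_
        (𝟙-cong (ok? (suc ℓ) D (map (shift x) ψ)) (ok? ℓ D ψ)
          (Ok-shift⁻ 1≤x x≤ D ψ) (Ok-shift⁺ 1≤x x≤ D ψ))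
        (cong h′ (weight-shift 1≤x x≤ D ψ)))))

  -- A fresh value can be inserted in one more way than an old one can be reused.
  choices-shift : ∀ {ℓ ψ} → ψ ⊆ oneTo (suc ℓ) →
    ∑ (oneTo (suc ℓ)) (λ x → 𝟙 (below? b x (shift x (headOr (suc ℓ) ψ)))) ≡ 1ℤ +ᶻ choices ℓ ψ
  choices-shift {ℓ} {ψ} ψ⊆ = trans
    (∑-oneTo-head ℓ (λ x → 𝟙 (below? b x (shift x y))))
    (cong₂ _+ᶻ_ (first b) (∑-cong (oneTo ℓ) λ x _ → rest b x))
    where
    y : ℕ
    y = headOr (suc ℓ) ψ
    1≤y : 1 ≤ y
    1≤y = proj₁ (headOr-bounds ψ⊆)
    first : ∀ b → 𝟙 (below? b 1 (shift 1 y)) ≡ 1ℤ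
    first true  = 𝟙-yes (1 <? shift 1 y) (subst (1 <_) (sym (shift-≥ 1≤y)) (s≤s 1≤y))
    first false = refl
    rest : ∀ b x → 𝟙 (below? b (suc x) (shift (suc x) y)) ≡ 𝟙 (below? b x y)
    rest false x = refl
    rest true  x = 𝟙-cong (suc x <? shift (suc x) y) (x <? y) to
      (λ x<y → subst (suc x <_) (sym (shift-≥ x<y)) (s≤s x<y))
      where
      to : suc x < shift (suc x) y → x < y
      to lt with ℕₚ.<-≤-connex y (suc x)
      ... | inj₂ x<y = x<y
      ... | inj₁ y<  = ⊥-elim (ℕₚ.<-asym y< (subst (suc x <_) (shift-< y<) lt))

  private
    U V C W : ℕ → ℤ
    U ℓ = ∑ (words (suc ℓ) M) (value ℓ D h)
    V ℓ = ∑ (words (suc ℓ) M) (value ℓ D h′)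
    C ℓ = ∑ (words (suc ℓ) M) (λ ψ → choices ℓ ψ *ᶻ value ℓ D h′ ψ)
    W ℓ = ∑ (words (suc ℓ) (suc M)) (value ℓ D⁺ h)

    fresh : ℕ → ℤ
    fresh ℓ = ∑ (oneTo ℓ) λ x → ∑ (words (suc ℓ) M) λ ψ → 𝟙 (x ∉? ψ) *ᶻ value ℓ D⁺ h (x ∷ ψ)

    swap-choices : ∀ ns A (f : ℕ → Word → ℤ) (g : Word → ℤ) →
      ∑ ns (λ x → ∑ (words A M) (λ ψ → f x ψ *ᶻ g ψ)) ≡
      ∑ (words A M) (λ ψ → ∑ ns (λ x → f x ψ) *ᶻ g ψ)
    swap-choices ns A f g = trans (∑-swap ns (words A M) (λ x ψ → f x ψ *ᶻ g ψ))
      (∑-cong (words A M) λ ψ _ → ∑-*ʳ ns (λ x → f x ψ) (g ψ))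

    W-split : ∀ ℓ → W ℓ ≡ (C ℓ +ᶻ fresh ℓ) +ᶻ ⟦ not b ⟧ *ᶻ U ℓ
    W-split ℓ = begin
      W ℓ
        ≡⟨ ∑-wordsOver (oneTo (suc ℓ)) M _ ⟩
      ∑ (oneTo (suc ℓ)) F
        ≡⟨ ∑-oneTo-last ℓ F ⟩
      ∑ (oneTo ℓ) F +ᶻ F (suc ℓ)
        ≡⟨ cong₂ _+ᶻ_
             (trans (∑-cong (oneTo ℓ) λ x x∈ → trans
                (∑-cong (words (suc ℓ) M) λ ψ _ → value-split ψ x∈)
                (∑-+ (words (suc ℓ) M) (reused x) (inserted x)))
              (trans (∑-+ (oneTo ℓ) (∑ (words (suc ℓ) M) ∘ reused) (∑ (words (suc ℓ) M) ∘ inserted))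
                (cong (_+ᶻ fresh ℓ) (swap-choices (oneTo ℓ) (suc ℓ)
                  (λ x ψ → 𝟙 (below? b x (headOr (suc ℓ) ψ))) (value ℓ D h′)))))
             (trans (∑-cong (words (suc ℓ) M) λ ψ ψ∈ →
                value-∞ (proj₂ (∈-wordsOver⁻ (oneTo (suc ℓ)) M ψ∈)))
              (∑-*ˡ ⟦ not b ⟧ (words (suc ℓ) M) _)) ⟩
      (C ℓ +ᶻ fresh ℓ) +ᶻ ⟦ not b ⟧ *ᶻ U ℓ ∎
      where
      open ≡-Reasoning
      F : ℕ → ℤ
      F x = ∑ (words (suc ℓ) M) λ ψ → value ℓ D⁺ h (x ∷ ψ)
      reused inserted : ℕ → Word → ℤ
      reused   x ψ = 𝟙 (below? b x (headOr (suc ℓ) ψ)) *ᶻ value ℓ D h′ ψ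
      inserted x ψ = 𝟙 (x ∉? ψ) *ᶻ value ℓ D⁺ h (x ∷ ψ)

    fresh-suc : ∀ ℓ → fresh (suc ℓ) ≡ V ℓ +ᶻ C ℓ
    fresh-suc ℓ = begin
      fresh (suc ℓ)
        ≡⟨ ∑-cong (oneTo (suc ℓ)) (λ x x∈ → let 1≤x , x≤ = ∈-oneTo⁻ x∈ in trans
             (∑-words-shift 1≤x (ℕₚ.m≤n⇒m≤1+n x≤) M _)
             (∑-cong (words (suc ℓ) M) λ ψ _ → value-shift ψ 1≤x x≤)) ⟩
      ∑ (oneTo (suc ℓ)) (λ x → ∑ (words (suc ℓ) M) λ ψ →
        𝟙 (below? b x (shift x (headOr (suc ℓ) ψ))) *ᶻ value ℓ D h′ ψ)
        ≡⟨ swap-choices (oneTo (suc ℓ)) (suc ℓ)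
             (λ x ψ → 𝟙 (below? b x (shift x (headOr (suc ℓ) ψ)))) (value ℓ D h′) ⟩
      ∑ (words (suc ℓ) M) (λ ψ →
        ∑ (oneTo (suc ℓ)) (λ x → 𝟙 (below? b x (shift x (headOr (suc ℓ) ψ)))) *ᶻ value ℓ D h′ ψ)
        ≡⟨ ∑-cong (words (suc ℓ) M) (λ ψ ψ∈ → trans
             (cong (_*ᶻ value ℓ D h′ ψ)
               (choices-shift (proj₂ (∈-wordsOver⁻ (oneTo (suc ℓ)) M ψ∈))))
             (lemma (choices ℓ ψ) (value ℓ D h′ ψ))) ⟩
      ∑ (words (suc ℓ) M) (λ ψ → value ℓ D h′ ψ +ᶻ choices ℓ ψ *ᶻ value ℓ D h′ ψ)
        ≡⟨ ∑-+ (words (suc ℓ) M) (value ℓ D h′) (λ ψ → choices ℓ ψ *ᶻ value ℓ D h′ ψ) ⟩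
      V ℓ +ᶻ C ℓ ∎
      where
      open ≡-Reasoning
      lemma : ∀ c v → (1ℤ +ᶻ c) *ᶻ v ≡ v +ᶻ c *ᶻ v
      lemma = solve-∀

    -- `C ℓ` occurs twice: in `W ℓ` through the reused values, and in W (ℓ + 1) through `fresh-suc`.
    -- The two carry opposite signs, so only the topmost `C L` is left.
    telescope : ∀ L → ∑ (upTo (suc L)) (λ ℓ → sign ℓ *ᶻ W ℓ) ≡
      (⟦ not b ⟧ *ᶻ ∑ (upTo (suc L)) (λ ℓ → sign ℓ *ᶻ U ℓ)
        +ᶻ - ∑ (upTo L) (λ ℓ → sign ℓ *ᶻ V ℓ)) +ᶻ sign L *ᶻ C L
    -- At ℓ = 0 there is no finite value, so `fresh 0` is the empty sum.
    telescope zero = trans (cong (λ w → 1ℤ *ᶻ w +ᶻ 0ℤ) (W-split 0))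
        (lemma (C 0) ⟦ not b ⟧ (U 0))
      where
      lemma : ∀ c k u → 1ℤ *ᶻ ((c +ᶻ 0ℤ) +ᶻ k *ᶻ u) +ᶻ 0ℤ ≡
        (k *ᶻ (1ℤ *ᶻ u +ᶻ 0ℤ) +ᶻ 0ℤ) +ᶻ 1ℤ *ᶻ c
      lemma = solve-∀
    telescope (suc L)
      rewrite ∑-upTo-last (suc L) (λ ℓ → sign ℓ *ᶻ W ℓ)
            | ∑-upTo-last (suc L) (λ ℓ → sign ℓ *ᶻ U ℓ)
            | ∑-upTo-last L (λ ℓ → sign ℓ *ᶻ V ℓ)
            | telescope L | W-split (suc L) | fresh-suc L =
      lemma ⟦ not b ⟧ (∑ (upTo (suc L)) (λ ℓ → sign ℓ *ᶻ U ℓ)) (∑ (upTo L) (λ ℓ → sign ℓ *ᶻ V ℓ))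
        (sign L) (C L) (C (suc L)) (V L) (U (suc L))
      where
      lemma : ∀ k u v s c c′ v′ u′ →
        ((k *ᶻ u +ᶻ - v) +ᶻ s *ᶻ c) +ᶻ (- s) *ᶻ ((c′ +ᶻ (v′ +ᶻ c)) +ᶻ k *ᶻ u′) ≡
        (k *ᶻ (u +ᶻ (- s) *ᶻ u′) +ᶻ - (v +ᶻ s *ᶻ v′)) +ᶻ (- s) *ᶻ c′
      lemma = solve-∀

    -- The boundary term dies because a word of length M cannot contain all of 1..L when L exceeds
    -- M.
    C-vanishes : ∀ {L} → M < L → C L ≡ 0ℤ
    C-vanishes {L} M<L = ∑-zero (words (suc L) M) λ ψ ψ∈ → trans
      (cong (λ s → choices L ψ *ᶻ (s *ᶻ (𝟙 (ok? L D ψ) *ᶻ h′ (weight L D ψ))))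
        (𝟙-no (surj? L ψ) λ s → ℕₚ.<⇒≱ M<L
          (subst (L ≤_) (proj₁ (∈-wordsOver⁻ (oneTo (suc L)) M ψ∈)) (Surj⇒≤ s))))
      (ℤₚ.*-zeroʳ (choices L ψ))

  signedSum-∷ : ∀ {L} → M < L →
    signedSum D⁺ (suc L) h ≡ ⟦ not b ⟧ *ᶻ signedSum D (suc L) h +ᶻ - signedSum D L h′
  signedSum-∷ {L} M<L = trans (telescope L)
    (trans (cong (λ c → signs +ᶻ sign L *ᶻ c) (C-vanishes M<L))
      (trans (cong (signs +ᶻ_) (ℤₚ.*-zeroʳ (sign L))) (ℤₚ.+-identityʳ signs)))
    where
    signs : ℤ
    signs = ⟦ not b ⟧ *ᶻ signedSum D (suc L) h +ᶻ - signedSum D L h′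

-- Each prepended letter lowers the cut-off of the translated sum by one, but it also shortens D by
-- one, so the bound `length D < L` persists. For empty D only ℓ = 0 contributes, as the empty word
-- contains no value.
signedSum≡blockProduct : ∀ D {L} h → length D < L → signedSum D L h ≡ blockProduct D h
signedSum≡blockProduct [] {suc L} h _ = begin
  signedSum [] (suc L) h
    ≡⟨ ∑-upTo-head L F ⟩
  F 0 +ᶻ ∑ (upTo L) (F ∘ suc)
    ≡⟨ cong₂ _+ᶻ_ (lemma (h 0)) (∑-zero (upTo L) λ ℓ _ → ℤₚ.*-zeroʳ (sign (suc ℓ))) ⟩
  h 0 +ᶻ 0ℤ
    ≡⟨ ℤₚ.+-identityʳ (h 0) ⟩
  h 0 ∎
  where
  open ≡-Reasoning
  F : ℕ → ℤ
  F ℓ = sign ℓ *ᶻ ∑ (words (suc ℓ) 0) (value ℓ [] h)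
  lemma : ∀ x → 1ℤ *ᶻ (1ℤ *ᶻ (1ℤ *ᶻ x) +ᶻ 0ℤ) ≡ x
  lemma = solve-∀
signedSum≡blockProduct ((b , i) ∷ D) {suc L} h (s≤s M<L) = trans
  (InsertLetter.signedSum-∷ b i D h M<L)
  (cong₂ (λ x y → ⟦ not b ⟧ *ᶻ x +ᶻ - y)
    (signedSum≡blockProduct D h (ℕₚ.m<n⇒m<1+n M<L))
    (signedSum≡blockProduct D (λ e → h (i + e)) M<L))

-- Compositions and evaluations

-- The local function of comps has no name outside Defs; the unifier recovers it.
mutual
  compsFrom : ℕ → ℕ → ℕ → List (List ℕ)
  compsFrom = _

  compsTail : ℕ → ℕ → List (List ℕ)
  compsTail = _

  comps-suc : ∀ k →
    comps (suc k) ≡ concatMap (λ i → map (λ I → suc i ∷ I) (compsTail k i)) (upTo (suc k))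
  comps-suc k = refl

  compsTail-≡ : ∀ k i → compsTail k i ≡ compsFrom (suc k) k (k ∸ i)
  compsTail-≡ k i with suc k | k ∸ i
  ... | p | j = compsFrom-refl p k j

  compsFrom-refl : ∀ p f j → compsFrom p f j ≡ compsFrom p f j
  compsFrom-refl p f j = refl

∈-compsFrom⁻ : ∀ p f j {I} → I ∈ compsFrom p f j → sum I ≡ j × All (1 ≤_) I
∈-compsFrom⁻ p f       zero    (here refl) = refl , []
∈-compsFrom⁻ p (suc f) (suc j) I∈
  with Is , I∈Is , Is∈ ← ∈-concat⁻′
    (map (λ i → map (λ I → suc i ∷ I) (compsFrom p f (j ∸ i))) (upTo (suc j))) I∈
  with i , i∈ , refl ← ∈-map⁻ (λ i → map (λ I → suc i ∷ I) (compsFrom p f (j ∸ i))) Is∈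
  with I′ , I′∈ , refl ← ∈-map⁻ (suc i ∷_) I∈Is
  with eq , pos ← ∈-compsFrom⁻ p f (j ∸ i) I′∈
  = cong suc (trans (cong (i ℕ.+_) eq) (ℕₚ.m+[n∸m]≡n (ℕₚ.≤-pred (∈-upTo⁻ i∈)))) , s≤s z≤n ∷ pos

-- Multiplicity one of c in the enumeration, by induction on its parts. The fuel suffices because
-- every part is positive: removing the first one lowers the sum by at least 1.
∑-compsFrom-δ : ∀ p f {c} → sum c ≤ f → All (1 ≤_) c → (g : List ℕ → ℤ) →
  ∑ (compsFrom p f (sum c)) (λ I → 𝟙 (I ≟ʷ c) *ᶻ g I) ≡ g c
∑-compsFrom-δ p f       {[]}        _         _         g = trans (ℤₚ.+-identityʳ _) (ℤₚ.*-identityˡ _)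
∑-compsFrom-δ p (suc f) {suc i ∷ c} (s≤s j≤f) (_ ∷ pos) g = begin
  ∑ (compsFrom p (suc f) (suc j)) (λ I → 𝟙 (I ≟ʷ (suc i ∷ c)) *ᶻ g I)
    ≡⟨ ∑-concatMap (λ i′ → map (λ I → suc i′ ∷ I) (rest i′)) (upTo (suc j)) _ ⟩
  ∑ (upTo (suc j)) (λ i′ → ∑ (map (λ I → suc i′ ∷ I) (rest i′)) (λ I → 𝟙 (I ≟ʷ (suc i ∷ c)) *ᶻ g I))
    ≡⟨ ∑-cong (upTo (suc j)) (λ i′ _ → trans
         (∑-map (λ I → suc i′ ∷ I) (rest i′) _)
         (trans
           (∑-cong (rest i′) λ I _ → trans
             (cong (_*ᶻ g (suc i′ ∷ I)) (trans
               (𝟙-cong ((suc i′ ∷ I) ≟ʷ (suc i ∷ c)) ((i′ ≟ i) ×-dec (I ≟ʷ c))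
                 (λ { refl → refl , refl }) (λ { (refl , refl) → refl }))
               (𝟙-× (i′ ≟ i) (I ≟ʷ c))))
             (ℤₚ.*-assoc (𝟙 (i′ ≟ i)) (𝟙 (I ≟ʷ c)) (g (suc i′ ∷ I))))
           (∑-*ˡ (𝟙 (i′ ≟ i)) (rest i′) (λ I → 𝟙 (I ≟ʷ c) *ᶻ g (suc i′ ∷ I))))) ⟩
  ∑ (upTo (suc j)) (λ i′ → 𝟙 (i′ ≟ i) *ᶻ ∑ (rest i′) (λ I → 𝟙 (I ≟ʷ c) *ᶻ g (suc i′ ∷ I)))
    ≡⟨ ∑-δ _≟_ (Uniqueₚ.upTo⁺ (suc j)) (∈-upTo⁺ (s≤s (ℕₚ.m≤m+n i (sum c))))
         (λ i′ → ∑ (rest i′) (λ I → 𝟙 (I ≟ʷ c) *ᶻ g (suc i′ ∷ I))) ⟩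
  ∑ (rest i) (λ I → 𝟙 (I ≟ʷ c) *ᶻ g (suc i ∷ I))
    ≡⟨ cong (λ m → ∑ (compsFrom p f m) (λ I → 𝟙 (I ≟ʷ c) *ᶻ g (suc i ∷ I))) (ℕₚ.m+n∸m≡n i (sum c)) ⟩
  ∑ (compsFrom p f (sum c)) (λ I → 𝟙 (I ≟ʷ c) *ᶻ g (suc i ∷ I))
    ≡⟨ ∑-compsFrom-δ p f (ℕₚ.m+n≤o⇒n≤o i j≤f) pos (λ I → g (suc i ∷ I)) ⟩
  g (suc i ∷ c) ∎
  where
  open ≡-Reasoning
  j : ℕ
  j = i + sum c
  rest : ℕ → List (List ℕ)
  rest i′ = compsFrom p f (j ∸ i′)

∈-comps⁻ : ∀ {k I} → I ∈ comps k → sum I ≡ k × All (1 ≤_) I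
∈-comps⁻ {k} = ∈-compsFrom⁻ k k k

∑-comps-δ : ∀ {c} → All (1 ≤_) c → (g : List ℕ → ℤ) →
  ∑ (comps (sum c)) (λ I → 𝟙 (I ≟ʷ c) *ᶻ g I) ≡ g c
∑-comps-δ {c} = ∑-compsFrom-δ (sum c) (sum c) ℕₚ.≤-refl

length≤sum : ∀ {I} → All (1 ≤_) I → length I ≤ sum I
length≤sum []         = z≤n
length≤sum (1≤i ∷ ps) = ℕₚ.+-mono-≤ 1≤i (length≤sum ps)

-- Combines the sign of (-t)^k with (-1)^(k-ℓ(I)), so that only the parity of the number of parts
-- survives. Lowering ℓ and k together reduces to the square of a sign.
sign-cancel : ∀ {ℓ k} → ℓ ≤ k → sign k *ᶻ sign (k ∸ ℓ) ≡ sign ℓ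
sign-cancel {k = k} z≤n = sign² k
  where
  neg-neg : ∀ s → (- s) *ᶻ (- s) ≡ s *ᶻ s
  neg-neg = solve-∀
  sign² : ∀ k → sign k *ᶻ sign k ≡ 1ℤ
  sign² zero    = refl
  sign² (suc k) = trans (neg-neg (sign k)) (sign² k)
sign-cancel (s≤s {ℓ} {k} ℓ≤k) =
  trans (sym (ℤₚ.neg-distribˡ-* (sign k) (sign (k ∸ ℓ)))) (cong -_ (sign-cancel ℓ≤k))

-- Letter multiplicities of words

map-cong-∈ : {A B : Set} {f g : A → B} (xs : List A) → (∀ x → x ∈ xs → f x ≡ g x) →
  map f xs ≡ map g xs
map-cong-∈ xs eq = Listₚ.map-cong-local (All.tabulate λ {x} → eq x)

sum-indicator : ∀ (f : ℕ → ℕ) {as x} → Unique as → x ∈ as →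
  sum (map (λ a → if a ≡ᵇ x then f a else 0) as) ≡ f x
sum-indicator f {as} {x} !as x∈ = go !as x∈
  where
  none : ∀ {as} → x ∉ as → sum (map (λ a → if a ≡ᵇ x then f a else 0) as) ≡ 0
  none {[]}     x∉ = refl
  none {a ∷ as} x∉ with a ≡ᵇ x in eq
  ... | true  = ⊥-elim (x∉ (here (sym (ℕₚ.≡ᵇ⇒≡ a x (subst T (sym eq) tt)))))
  ... | false = none (x∉ ∘ there)
  go : ∀ {as} → Unique as → x ∈ as → sum (map (λ a → if a ≡ᵇ x then f a else 0) as) ≡ f x
  go {a ∷ as} (a∉ ∷ !as) x∈ with a ≡ᵇ x in eq
  go {a ∷ as} (a∉ ∷ !as) x∈ | true with refl ← ℕₚ.≡ᵇ⇒≡ a x (subst T (sym eq) tt) =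
    trans (cong (f x ℕ.+_) (none λ x∈as → All.lookup a∉ x∈as refl)) (ℕₚ.+-identityʳ (f x))
  go {a ∷ as} (a∉ ∷ !as) (here refl) | false = ⊥-elim (subst T eq (ℕₚ.≡⇒≡ᵇ a a refl))
  go {a ∷ as} (a∉ ∷ !as) (there x∈)  | false = go !as x∈

sum-map-+ : ∀ (f g : ℕ → ℕ) as → sum (map (λ a → f a + g a) as) ≡ sum (map f as) + sum (map g as)
sum-map-+ f g []       = refl
sum-map-+ f g (a ∷ as) rewrite sum-map-+ f g as = ℕ-lemma (f a) (g a) _ _
  where
  ℕ-lemma : ∀ a b c d → (a + b) + (c + d) ≡ (a + c) + (b + d)
  ℕ-lemma = ℕ-solve-∀

-- Double counting: positions of w grouped by their letter. It turns weights summed over positions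
-- into weights summed over letters with multiplicity.
sum-by-letter : ∀ (f : ℕ → ℕ) {as} → Unique as → ∀ {w} → w ⊆ as →
  sum (map (λ a → count a w ℕ.* f a) as) ≡ sum (map f w)
sum-by-letter f {as} !as {[]} w⊆ = zeros as
  where
  zeros : ∀ as → sum (map (λ (_ : ℕ) → 0) as) ≡ 0
  zeros []       = refl
  zeros (_ ∷ as) = zeros as
sum-by-letter f {as} !as {x ∷ w} w⊆ = begin
  sum (map (λ a → count a (x ∷ w) ℕ.* f a) as)
    ≡⟨ cong sum (Listₚ.map-cong letter as) ⟩
  sum (map (λ a → (if a ≡ᵇ x then f a else 0) + count a w ℕ.* f a) as)
    ≡⟨ sum-map-+ _ _ as ⟩
  sum (map (λ a → if a ≡ᵇ x then f a else 0) as) + sum (map (λ a → count a w ℕ.* f a) as)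
    ≡⟨ cong₂ _+_ (sum-indicator f !as (w⊆ (here refl))) (sum-by-letter f !as (w⊆ ∘ there)) ⟩
  f x + sum (map f w) ∎
  where
  open ≡-Reasoning
  letter : ∀ a → count a (x ∷ w) ℕ.* f a ≡ (if a ≡ᵇ x then f a else 0) + count a w ℕ.* f a
  letter a with a ≡ᵇ x
  ... | true  = refl
  ... | false = refl

count⇒∈ : ∀ {a} w → 1 ≤ count a w → a ∈ w
count⇒∈ {a} (x ∷ w) 1≤ with a ≡ᵇ x in eq
... | true  = here (ℕₚ.≡ᵇ⇒≡ a x (subst T (sym eq) tt))
... | false = there (count⇒∈ w 1≤)

∈⇒count : ∀ {a w} → a ∈ w → 1 ≤ count a w
∈⇒count {a} {x ∷ w} a∈ with a ≡ᵇ x in eq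
∈⇒count {a} {x ∷ w} a∈          | true  = s≤s z≤n
∈⇒count {a} {x ∷ w} (here refl) | false = ⊥-elim (subst T eq (ℕₚ.≡⇒≡ᵇ a a refl))
∈⇒count {a} {x ∷ w} (there a∈)  | false = ∈⇒count a∈

counts : ℕ → Word → List ℕ
counts ℓ w = map (λ a → count a w) (oneTo ℓ)

length-counts : ∀ ℓ w → length (counts ℓ w) ≡ ℓ
length-counts ℓ w = trans (Listₚ.length-map _ (oneTo ℓ)) (length-oneTo ℓ)

counts-∷ʳ : ∀ ℓ w → counts (suc ℓ) w ≡ counts ℓ w ∷ʳ count (suc ℓ) w
counts-∷ʳ ℓ w = trans (cong (map _) (oneTo-∷ʳ ℓ)) (Listₚ.map-++ _ (oneTo ℓ) (suc ℓ ∷ []))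

Surj⇒counts>0 : ∀ {ℓ w} → Surj ℓ w → All (1 ≤_) (counts ℓ w)
Surj⇒counts>0 s = Allₚ.map⁺ (All.map ∈⇒count s)

counts>0⇒Surj : ∀ {ℓ w} → All (1 ≤_) (counts ℓ w) → Surj ℓ w
counts>0⇒Surj {w = w} pos = All.map (count⇒∈ w) (Allₚ.map⁻ pos)

finiteSize : ℕ → Word → ℕ
finiteSize ℓ w = sum (map (cost ℓ 1) w)

sum-∷ʳ : ∀ ns n → sum (ns ∷ʳ n) ≡ sum ns + n
sum-∷ʳ []       n = ℕₚ.+-identityʳ n
sum-∷ʳ (m ∷ ns) n = trans (cong (m ℕ.+_) (sum-∷ʳ ns n)) (sym (ℕₚ.+-assoc m (sum ns) n))

sum-counts≡finiteSize : ∀ {ℓ w} → w ⊆ oneTo (suc ℓ) → sum (counts ℓ w) ≡ finiteSize ℓ w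
sum-counts≡finiteSize {ℓ} {w} w⊆ = begin
  sum (counts ℓ w)
    ≡⟨ cong sum (map-cong-∈ (oneTo ℓ) λ a a∈ → trans (sym (ℕₚ.*-identityʳ (count a w)))
         (cong (count a w ℕ.*_) (sym (cost-≢ 1 (ℕₚ.<⇒≢ (s≤s (proj₂ (∈-oneTo⁻ a∈)))))))) ⟩
  sum (map F (oneTo ℓ))
    -- The infinite letter costs 0, so its term may be added; grouping by letters then runs over the
    -- whole alphabet of w.
    ≡⟨ ℕₚ.+-identityʳ _ ⟨
  sum (map F (oneTo ℓ)) + 0
    ≡⟨ cong (sum (map F (oneTo ℓ)) ℕ.+_)
         (trans (cong (count (suc ℓ) w ℕ.*_) (cost-∞ ℓ 1)) (ℕₚ.*-zeroʳ (count (suc ℓ) w))) ⟨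
  sum (map F (oneTo ℓ)) + F (suc ℓ)
    ≡⟨ sum-∷ʳ (map F (oneTo ℓ)) (F (suc ℓ)) ⟨
  sum (map F (oneTo ℓ) ∷ʳ F (suc ℓ))
    ≡⟨ cong sum (Listₚ.map-++ F (oneTo ℓ) (suc ℓ ∷ [])) ⟨
  sum (map F (oneTo ℓ ∷ʳ suc ℓ))
    ≡⟨ cong (sum ∘ map F) (oneTo-∷ʳ ℓ) ⟨
  sum (map F (oneTo (suc ℓ)))
    ≡⟨ sum-by-letter (cost ℓ 1) (oneTo-unique (suc ℓ)) w⊆ ⟩
  finiteSize ℓ w ∎
  where
  open ≡-Reasoning
  F : ℕ → ℕ
  F a = count a w ℕ.* cost ℓ 1 a

sum-counts≡length : ∀ {A w} → w ⊆ oneTo A → sum (counts A w) ≡ length w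
sum-counts≡length {A} {w} w⊆ = begin
  sum (counts A w)
    ≡⟨ cong sum (Listₚ.map-cong (λ a → sym (ℕₚ.*-identityʳ (count a w))) (oneTo A)) ⟩
  sum (map (λ a → count a w ℕ.* 1) (oneTo A))
    ≡⟨ sum-by-letter (λ _ → 1) (oneTo-unique A) w⊆ ⟩
  sum (map (λ _ → 1) w)
    ≡⟨ ones w ⟩
  length w ∎
  where
  open ≡-Reasoning
  ones : ∀ (w : Word) → sum (map (λ _ → 1) w) ≡ length w
  ones []      = refl
  ones (_ ∷ w) = cong suc (ones w)

sum-counts+count : ∀ {ℓ w} → w ⊆ oneTo (suc ℓ) → sum (counts ℓ w) + count (suc ℓ) w ≡ length w
sum-counts+count {ℓ} {w} w⊆ = trans (sym (sum-∷ʳ (counts ℓ w) _))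
  (trans (cong sum (sym (counts-∷ʳ ℓ w))) (sum-counts≡length w⊆))

sum-counts≤length : ∀ {ℓ w} → w ⊆ oneTo (suc ℓ) → sum (counts ℓ w) ≤ length w
sum-counts≤length {ℓ} {w} w⊆ = subst (sum (counts ℓ w) ≤_) (sum-counts+count w⊆)
  (ℕₚ.m≤m+n (sum (counts ℓ w)) (count (suc ℓ) w))

∈⇒≤maxL : ∀ {a w} → a ∈ w → a ≤ maxL w
∈⇒≤maxL {w = x ∷ w} (here refl) = ℕₚ.m≤m⊔n x (maxL w)
∈⇒≤maxL {w = x ∷ w} (there a∈)  = ℕₚ.≤-trans (∈⇒≤maxL a∈) (ℕₚ.m≤n⊔m x (maxL w))

maxL≤ : ∀ {A} w → (∀ {a} → a ∈ w → a ≤ A) → maxL w ≤ A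
maxL≤ []      bound = z≤n
maxL≤ (x ∷ w) bound = ℕₚ.⊔-lub (bound (here refl)) (maxL≤ w (bound ∘ there))

Surj⇒maxL : ∀ {A w} → w ⊆ oneTo A → Surj A w → maxL w ≡ A
Surj⇒maxL {A} {w} w⊆ s = ℕₚ.≤-antisym (maxL≤ w (proj₂ ∘ ∈-oneTo⁻ ∘ w⊆)) (lower A s)
  where
  lower : ∀ A → Surj A w → A ≤ maxL w
  lower zero    s = z≤n
  lower (suc A) s = ∈⇒≤maxL (Surj⁻ s (s≤s z≤n) ℕₚ.≤-refl)

eqWord≡does : ∀ u v → eqWord u v ≡ does (u ≟ʷ v)
eqWord≡does []      []      = refl
eqWord≡does []      (_ ∷ _) = refl
eqWord≡does (_ ∷ _) []      = refl
eqWord≡does (a ∷ u) (b ∷ v) = cong ((a ≡ᵇ b) ∧_) (eqWord≡does u v)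

-- `ev` counts up to the maximal letter of w, `counts` up to a fixed bound. One direction compares
-- lengths; in the other, positivity of J makes every letter up to `length J` occur, so that this
-- bound is the maximum.
𝟙-ev : ∀ {w J} → All (1 ≤_) J → w ⊆ oneTo (length J) →
  ⟦ eqWord (ev w) J ⟧ ≡ 𝟙 (J ≟ʷ counts (length J) w)
𝟙-ev {w} {J} pos w⊆ = trans (cong ⟦_⟧ (eqWord≡does (ev w) J))
  (𝟙-cong (ev w ≟ʷ J) (J ≟ʷ counts (length J) w)
    (λ eq → trans (sym eq) (cong (λ A → counts A w)
      (trans (sym (length-counts (maxL w) w)) (cong length eq))))
    (λ eq → trans
      (cong (λ A → counts A w) (Surj⇒maxL w⊆ (counts>0⇒Surj (subst (All (1 ≤_)) eq pos))))
      (sym eq)))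

map-shift-id : ∀ {A w} → w ⊆ oneTo A → map (shift (suc A)) w ≡ w
map-shift-id {w = []}    w⊆ = refl
map-shift-id {w = x ∷ w} w⊆ = cong₂ _∷_
  (shift-< (s≤s (proj₂ (∈-oneTo⁻ (w⊆ (here refl)))))) (map-shift-id (w⊆ ∘ there))

-- At x = A + 1 the shift fixes all words over 1..A. This allows the case k = n, where the last part
-- is omitted, to be written with the infinite letter in the alphabet as well.
∑-words-∌ : ∀ {A n} (f : Word → ℤ) →
  (∀ {w} → w ∈ words (suc A) n → suc A ∈ w → f w ≡ 0ℤ) → ∑ (words (suc A) n) f ≡ ∑ (words A n) f
∑-words-∌ {A} {n} f vanish = begin
  ∑ (words (suc A) n) f
    ≡⟨ ∑-cong (words (suc A) n) (λ w w∈ → avoid w∈ (suc A ∈? w)) ⟩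
  ∑ (words (suc A) n) (λ w → 𝟙 (suc A ∉? w) *ᶻ f w)
    ≡⟨ ∑-words-shift (s≤s z≤n) ℕₚ.≤-refl n f ⟩
  ∑ (words A n) (f ∘ map (shift (suc A)))
    ≡⟨ ∑-cong (words A n) (λ w w∈ → cong f (map-shift-id (proj₂ (∈-wordsOver⁻ (oneTo A) n w∈)))) ⟩
  ∑ (words A n) f ∎
  where
  open ≡-Reasoning
  avoid : ∀ {w} → w ∈ words (suc A) n → Dec (suc A ∈ w) → f w ≡ 𝟙 (suc A ∉? w) *ᶻ f w
  avoid {w} w∈ (yes A∈) = trans (vanish w∈ A∈)
    (cong (_*ᶻ f w) (sym (𝟙-no (suc A ∉? w) λ A∉ → A∉ A∈)))
  avoid {w} w∈ (no A∉)  = trans (sym (ℤₚ.*-identityˡ (f w)))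
    (cong (_*ᶻ f w) (sym (𝟙-yes (suc A ∉? w) A∉)))

∑-wordsEv : ∀ {J} → All (1 ≤_) J → (X : Word → ℤ) →
  ∑ (wordsEv J) X ≡ ∑ (words (length J) (sum J)) (λ w → 𝟙 (J ≟ʷ counts (length J) w) *ᶻ X w)
∑-wordsEv {J} pos X = trans (∑-filterᵇ _ (words (length J) (sum J)) X)
  (∑-cong (words (length J) (sum J)) λ w w∈ →
    cong (_*ᶻ X w) (𝟙-ev pos (proj₂ (∈-wordsOver⁻ (oneTo (length J)) (sum J) w∈))))

-- The multiplicity of the extra letter is forced to be n - k by the length, so prescribing the
-- other multiplicities is enough. This form is uniform in k, whether or not the last part is
-- present.
∑-wordsEv-lastPart : ∀ {n k I} → sum I ≡ k → k ≤ n → All (1 ≤_) I → (X : Word → ℤ) →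
  ∑ (wordsEv (I ++ lastPart (n ∸ k))) X ≡
  ∑ (words (suc (length I)) n) (λ w → 𝟙 (I ≟ʷ counts (length I) w) *ᶻ X w)
∑-wordsEv-lastPart {n} {k} {I} ΣI k≤n pos X with n ∸ k in eq
... | zero = begin
  ∑ (wordsEv (I ++ [])) X
    ≡⟨ cong (λ J → ∑ (wordsEv J) X) (Listₚ.++-identityʳ I) ⟩
  ∑ (wordsEv I) X
    ≡⟨ ∑-wordsEv pos X ⟩
  ∑ (words (length I) (sum I)) F
    ≡⟨ cong (λ m → ∑ (words (length I) m) F) (trans ΣI k≡n) ⟩
  ∑ (words (length I) n) F
    ≡⟨ ∑-words-∌ {length I} {n} F vanish ⟨
  ∑ (words (suc (length I)) n) F ∎
  where
  open ≡-Reasoning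
  F : Word → ℤ
  F w = 𝟙 (I ≟ʷ counts (length I) w) *ᶻ X w
  k≡n : k ≡ n
  k≡n = ℕₚ.≤-antisym k≤n (ℕₚ.m∸n≡0⇒m≤n eq)
  -- An occurrence of the extra letter would leave fewer than n positions for the letters counted by
  -- I.
  vanish : ∀ {w} → w ∈ words (suc (length I)) n → suc (length I) ∈ w → F w ≡ 0ℤ
  vanish {w} w∈ ∈w = cong (_*ᶻ X w) (𝟙-no (I ≟ʷ counts (length I) w) λ I≡ →
    let lw , w⊆ = ∈-wordsOver⁻ (oneTo (suc (length I))) n w∈ in
    ℕₚ.<⇒≢ (ℕₚ.m<m+n (sum (counts (length I) w)) (∈⇒count ∈w))
      (trans (trans (cong sum (sym I≡)) (trans ΣI k≡n)) (sym (trans (sum-counts+count w⊆) lw))))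
... | suc r = begin
  ∑ (wordsEv J) X
    ≡⟨ ∑-wordsEv (Allₚ.++⁺ pos (s≤s z≤n ∷ [])) X ⟩
  ∑ (words (length J) (sum J)) (λ w → 𝟙 (J ≟ʷ counts (length J) w) *ᶻ X w)
    ≡⟨ cong₂ (λ A m → ∑ (words A m) (λ w → 𝟙 (J ≟ʷ counts A w) *ᶻ X w)) lJ ΣJ ⟩
  ∑ (words (suc (length I)) n) (λ w → 𝟙 (J ≟ʷ counts (suc (length I)) w) *ᶻ X w)
    ≡⟨ ∑-cong (words (suc (length I)) n) (λ w w∈ → cong (_*ᶻ X w)
         (𝟙-cong (J ≟ʷ counts (suc (length I)) w) (I ≟ʷ counts (length I) w)
           (λ J≡ → Listₚ.∷ʳ-injectiveˡ I (counts (length I) w) (trans J≡ (counts-∷ʳ (length I) w)))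
           (λ I≡ → trans (cong₂ _∷ʳ_ I≡ (last w∈ I≡)) (sym (counts-∷ʳ (length I) w))))) ⟩
  ∑ (words (suc (length I)) n) (λ w → 𝟙 (I ≟ʷ counts (length I) w) *ᶻ X w) ∎
  where
  open ≡-Reasoning
  J : List ℕ
  J = I ∷ʳ suc r
  k+r≡n : k + suc r ≡ n
  k+r≡n = trans (cong (k ℕ.+_) (sym eq)) (ℕₚ.m+[n∸m]≡n k≤n)
  lJ : length J ≡ suc (length I)
  lJ = trans (Listₚ.length-++ I) (ℕₚ.+-comm (length I) 1)
  ΣJ : sum J ≡ n
  ΣJ = trans (sum-∷ʳ I (suc r)) (trans (cong (_+ suc r) ΣI) k+r≡n)
  last : ∀ {w} → w ∈ words (suc (length I)) n → I ≡ counts (length I) w →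
    suc r ≡ count (suc (length I)) w
  last {w} w∈ I≡ =
    let lw , w⊆ = ∈-wordsOver⁻ (oneTo (suc (length I))) n w∈ in
    ℕₚ.+-cancelˡ-≡ k _ _ (trans k+r≡n (trans (sym (trans (sum-counts+count w⊆) lw))
      (cong (_+ count (suc (length I)) w) (trans (cong sum (sym I≡)) ΣI))))

-- Θ_n as a signed sum over words

evaluate : (ℕ → ℤ) → (Word → ℤ) → Term → ℤ
evaluate h X (c , e , w) = c *ᶻ (h e *ᶻ X w)

-- A coefficient is a value of the functional `evaluate`, with indicators testing the exponent and
-- the word. In this form multiplication by N_u merely replaces w by `pack u w` in the second
-- indicator.
coeff≡∑ : ∀ ts v m → coeff ts v m ≡ ∑ ts (evaluate (λ e → ⟦ e ≡ᵇ m ⟧) (λ w → 𝟙 (w ≟ʷ v)))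
coeff≡∑ []                 v m = refl
coeff≡∑ ((c , e , w) ∷ ts) v m rewrite sym (eqWord≡does w v) with e ≡ᵇ m | eqWord w v
... | true  | true  = cong₂ _+ᶻ_ (sym (ℤₚ.*-identityʳ c)) (coeff≡∑ ts v m)
... | true  | false = trans (sym (ℤₚ.+-identityˡ _)) (cong₂ _+ᶻ_ (sym (ℤₚ.*-zeroʳ c)) (coeff≡∑ ts v m))
... | false | _     = trans (sym (ℤₚ.+-identityˡ _)) (cong₂ _+ᶻ_ (sym (ℤₚ.*-zeroʳ c)) (coeff≡∑ ts v m))

∑-starN : ∀ u ts v (h : ℕ → ℤ) →
  ∑ (starN u ts) (evaluate h (λ w → 𝟙 (w ≟ʷ v))) ≡ ∑ ts (evaluate h (λ w → 𝟙 (pack u w ≟ʷ v)))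
∑-starN u []                 v h = refl
∑-starN u ((c , e , w) ∷ ts) v h = cong (evaluate h (λ w → 𝟙 (pack u w ≟ʷ v)) (c , e , w) +ᶻ_) (∑-starN u ts v h)

-- A word w over 1..ℓ+1 containing all of 1..ℓ comes from exactly one pair (k, I): I lists its
-- finite multiplicities and k is their sum. The summations are exchanged until w is outside those
-- over k and I, which then collapse.
∑-Theta : ∀ n (h : ℕ → ℤ) (X : Word → ℤ) →
  ∑ (Theta n) (evaluate h X) ≡
  ∑ (upTo (suc n)) (λ ℓ → sign ℓ *ᶻ
    ∑ (words (suc ℓ) n) (λ w → 𝟙 (surj? ℓ w) *ᶻ (h (finiteSize ℓ w) *ᶻ X w)))
∑-Theta n h X = begin
  ∑ (Theta n) (evaluate h X)
    ≡⟨ ∑-concatMap (λ k → concatMap (terms k) (comps k)) (upTo (suc n)) (evaluate h X) ⟩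
  ∑ (upTo (suc n)) (λ k → ∑ (concatMap (terms k) (comps k)) (evaluate h X))
    ≡⟨ ∑-cong (upTo (suc n)) (λ k k∈ → trans (∑-concatMap (terms k) (comps k) (evaluate h X))
         (∑-cong (comps k) λ I I∈ → inner (ℕₚ.≤-pred (∈-upTo⁻ k∈)) I∈)) ⟩
  ∑ (upTo (suc n)) (λ k → ∑ (comps k) λ I → ∑ (upTo (suc n)) λ ℓ → ∑ (words (suc ℓ) n) λ w → G k I ℓ w)
    ≡⟨ ∑-cong (upTo (suc n)) (λ k _ → trans
         (∑-swap (comps k) (upTo (suc n)) (λ I ℓ → ∑ (words (suc ℓ) n) (G k I ℓ)))
         (∑-cong (upTo (suc n)) λ ℓ _ → ∑-swap (comps k) (words (suc ℓ) n) (λ I w → G k I ℓ w))) ⟩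
  ∑ (upTo (suc n)) (λ k → ∑ (upTo (suc n)) λ ℓ → ∑ (words (suc ℓ) n) λ w → ∑ (comps k) λ I → G k I ℓ w)
    ≡⟨ trans
         (∑-swap (upTo (suc n)) (upTo (suc n))
           (λ k ℓ → ∑ (words (suc ℓ) n) λ w → ∑ (comps k) λ I → G k I ℓ w))
         (∑-cong (upTo (suc n)) λ ℓ _ →
         ∑-swap (upTo (suc n)) (words (suc ℓ) n) (λ k w → ∑ (comps k) λ I → G k I ℓ w)) ⟩
  ∑ (upTo (suc n)) (λ ℓ → ∑ (words (suc ℓ) n) λ w → ∑ (upTo (suc n)) λ k → ∑ (comps k) λ I → G k I ℓ w)
    ≡⟨ ∑-cong (upTo (suc n)) (λ ℓ _ → trans
         (∑-cong (words (suc ℓ) n) λ w w∈ → byWord ℓ w∈)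
         (∑-*ˡ (sign ℓ) (words (suc ℓ) n) (λ w → 𝟙 (surj? ℓ w) *ᶻ (h (finiteSize ℓ w) *ᶻ X w)))) ⟩
  ∑ (upTo (suc n)) (λ ℓ → sign ℓ *ᶻ
    ∑ (words (suc ℓ) n) (λ w → 𝟙 (surj? ℓ w) *ᶻ (h (finiteSize ℓ w) *ᶻ X w))) ∎
  where
  open ≡-Reasoning

  terms : ℕ → List ℕ → List Term
  terms k I = map (λ w → sign k *ᶻ sign (k ∸ length I) , k , w) (wordsEv (I ++ lastPart (n ∸ k)))

  G : ℕ → List ℕ → ℕ → Word → ℤ
  G k I ℓ w = 𝟙 (I ≟ʷ counts ℓ w) *ᶻ (sign ℓ *ᶻ (h k *ᶻ X w))

  inner : ∀ {k I} → k ≤ n → I ∈ comps k →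
    ∑ (terms k I) (evaluate h X) ≡
    ∑ (upTo (suc n)) (λ ℓ → ∑ (words (suc ℓ) n) λ w → G k I ℓ w)
  inner {k} {I} k≤n I∈ with ΣI , pos ← ∈-comps⁻ {k} I∈ = begin
    ∑ (terms k I) (evaluate h X)
      ≡⟨ ∑-map _ (wordsEv (I ++ lastPart (n ∸ k))) _ ⟩
    ∑ (wordsEv (I ++ lastPart (n ∸ k))) (λ w → (sign k *ᶻ sign (k ∸ length I)) *ᶻ (h k *ᶻ X w))
      ≡⟨ ∑-wordsEv-lastPart ΣI k≤n pos _ ⟩
    ∑ (words (suc (length I)) n) (λ w →
      𝟙 (I ≟ʷ counts (length I) w) *ᶻ ((sign k *ᶻ sign (k ∸ length I)) *ᶻ (h k *ᶻ X w)))
      ≡⟨ ∑-cong (words (suc (length I)) n) (λ w _ →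
           cong (λ s → 𝟙 (I ≟ʷ counts (length I) w) *ᶻ (s *ᶻ (h k *ᶻ X w))) (sign-cancel ℓ≤k)) ⟩
    ∑ (words (suc (length I)) n) (G k I (length I))
      ≡⟨ ∑-δ _≟_ (Uniqueₚ.upTo⁺ (suc n)) (∈-upTo⁺ (s≤s (ℕₚ.≤-trans ℓ≤k k≤n)))
           (λ ℓ → ∑ (words (suc ℓ) n) (G k I ℓ)) ⟨
    ∑ (upTo (suc n)) (λ ℓ → 𝟙 (ℓ ≟ length I) *ᶻ ∑ (words (suc ℓ) n) (G k I ℓ))
      -- The test ℓ = `length I` may go: the equation I = `counts ℓ w` inside already forces it.
      ≡⟨ ∑-cong (upTo (suc n)) (λ ℓ _ → drop ℓ (ℓ ≟ length I)) ⟩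
    ∑ (upTo (suc n)) (λ ℓ → ∑ (words (suc ℓ) n) (G k I ℓ)) ∎
    where
    ℓ≤k : length I ≤ k
    ℓ≤k = subst (length I ≤_) ΣI (length≤sum pos)
    drop : ∀ ℓ (eq? : Dec (ℓ ≡ length I)) →
      𝟙 eq? *ᶻ ∑ (words (suc ℓ) n) (G k I ℓ) ≡ ∑ (words (suc ℓ) n) (G k I ℓ)
    drop ℓ (yes _) = ℤₚ.*-identityˡ _
    drop ℓ (no ℓ≢) = sym (∑-zero (words (suc ℓ) n) λ w _ →
      cong (_*ᶻ (sign ℓ *ᶻ (h k *ᶻ X w))) (𝟙-no (I ≟ʷ counts ℓ w) λ eq →
        ℓ≢ (trans (sym (length-counts ℓ w)) (cong length (sym eq)))))

  byWord : ∀ ℓ {w} → w ∈ words (suc ℓ) n → ∑ (upTo (suc n)) (λ k → ∑ (comps k) λ I → G k I ℓ w) ≡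
    sign ℓ *ᶻ (𝟙 (surj? ℓ w) *ᶻ (h (finiteSize ℓ w) *ᶻ X w))
  byWord ℓ {w} w∈ with lw , w⊆ ← ∈-wordsOver⁻ (oneTo (suc ℓ)) n w∈ = begin
    ∑ (upTo (suc n)) (λ k → ∑ (comps k) λ I → G k I ℓ w)
      ≡⟨ ∑-cong (upTo (suc n)) (λ k _ → byTotal k (k ≟ sum (counts ℓ w)) (surj? ℓ w)) ⟩
    ∑ (upTo (suc n)) (λ k → 𝟙 (k ≟ sum (counts ℓ w)) *ᶻ Y k)
      ≡⟨ ∑-δ _≟_ (Uniqueₚ.upTo⁺ (suc n))
           (∈-upTo⁺ (s≤s (subst (sum (counts ℓ w) ≤_) lw (sum-counts≤length w⊆)))) Y ⟩
    Y (sum (counts ℓ w))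
      ≡⟨ cong Y (sum-counts≡finiteSize w⊆) ⟩
    Y (finiteSize ℓ w)
      ≡⟨ lemma (𝟙 (surj? ℓ w)) (sign ℓ) (h (finiteSize ℓ w)) (X w) ⟩
    sign ℓ *ᶻ (𝟙 (surj? ℓ w) *ᶻ (h (finiteSize ℓ w) *ᶻ X w)) ∎
    where
    Y : ℕ → ℤ
    Y k = 𝟙 (surj? ℓ w) *ᶻ (sign ℓ *ᶻ (h k *ᶻ X w))
    lemma : ∀ a s b x → a *ᶻ (s *ᶻ (b *ᶻ x)) ≡ s *ᶻ (a *ᶻ (b *ᶻ x))
    lemma = solve-∀
    -- The multiplicities form a composition, that is, are all positive, exactly when every finite
    -- letter occurs.
    byTotal : ∀ k (k? : Dec (k ≡ sum (counts ℓ w))) (s? : Dec (Surj ℓ w)) →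
      ∑ (comps k) (λ I → G k I ℓ w) ≡ 𝟙 k? *ᶻ (𝟙 s? *ᶻ (sign ℓ *ᶻ (h k *ᶻ X w)))
    byTotal k (yes refl) (yes s) = trans (∑-comps-δ (Surj⇒counts>0 s) (λ _ → sign ℓ *ᶻ (h k *ᶻ X w)))
      (one (sign ℓ *ᶻ (h k *ᶻ X w)))
      where
      one : ∀ x → x ≡ 1ℤ *ᶻ (1ℤ *ᶻ x)
      one = solve-∀
    byTotal k (yes _) (no ¬s) = ∑-zero (comps k) λ I I∈ →
      cong (_*ᶻ (sign ℓ *ᶻ (h k *ᶻ X w))) (𝟙-no (I ≟ʷ counts ℓ w) λ { refl →
        ¬s (counts>0⇒Surj (proj₂ (∈-comps⁻ {k} I∈))) })
    byTotal k (no k≢) s? = ∑-zero (comps k) λ I I∈ →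
      cong (_*ᶻ (sign ℓ *ᶻ (h k *ᶻ X w))) (𝟙-no (I ≟ʷ counts ℓ w) λ { refl →
        k≢ (sym (proj₁ (∈-comps⁻ {k} I∈))) })

-- Packing

T⇒≡true : ∀ {b} → T b → b ≡ true
T⇒≡true {true} _ = refl

¬T⇒≡false : ∀ {b} → ¬ T b → b ≡ false
¬T⇒≡false {true}  ¬t = ⊥-elim (¬t tt)
¬T⇒≡false {false} ¬t = refl

filterᵇ≡filter : {A : Set} (p : A → Bool) (xs : List A) → filterᵇ p xs ≡ filter (T? ∘ p) xs
filterᵇ≡filter p []       = refl
filterᵇ≡filter p (x ∷ xs) with p x
... | true  = cong (x ∷_) (filterᵇ≡filter p xs)
... | false = filterᵇ≡filter p xs

module _ {A : Set} (p : A → Bool) where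

  ∈-filterᵇ⁺ : ∀ {x xs} → x ∈ xs → T (p x) → x ∈ filterᵇ p xs
  ∈-filterᵇ⁺ {x} {xs} x∈ px = subst (x ∈_) (sym (filterᵇ≡filter p xs)) (∈-filter⁺ (T? ∘ p) x∈ px)

  ∈-filterᵇ⁻ : ∀ {x xs} → x ∈ filterᵇ p xs → x ∈ xs × T (p x)
  ∈-filterᵇ⁻ {x} {xs} x∈ = ∈-filter⁻ (T? ∘ p) (subst (x ∈_) (filterᵇ≡filter p xs) x∈)

  filterᵇ-unique : ∀ {xs} → Unique xs → Unique (filterᵇ p xs)
  filterᵇ-unique {xs} !xs = subst Unique (sym (filterᵇ≡filter p xs)) (Uniqueₚ.filter⁺ (T? ∘ p) !xs)

eqPair⇒≡ : ∀ p q → T (eqPair p q) → p ≡ q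
eqPair⇒≡ (a , b) (c , d) t with a≡c , b≡d ← Equivalence.to T-∧ t =
  cong₂ _,_ (ℕₚ.≡ᵇ⇒≡ a c a≡c) (ℕₚ.≡ᵇ⇒≡ b d b≡d)

eqPair-refl : ∀ p → T (eqPair p p)
eqPair-refl (a , b) = Equivalence.from T-∧ (ℕₚ.≡⇒≡ᵇ a a refl , ℕₚ.≡⇒≡ᵇ b b refl)

infix 4 _≺_
_≺_ : ℕ × ℕ → ℕ × ℕ → Set
(a , b) ≺ (c , d) = a < c ⊎ (a ≡ c × b < d)

lexLt⇒≺ : ∀ p q → T (lexLt p q) → p ≺ q
lexLt⇒≺ (a , b) (c , d) t with Equivalence.to T-∨ t
... | inj₁ a<c = inj₁ (ℕₚ.<ᵇ⇒< a c a<c)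
... | inj₂ t′ with a≡c , b<d ← Equivalence.to T-∧ t′ = inj₂ (ℕₚ.≡ᵇ⇒≡ a c a≡c , ℕₚ.<ᵇ⇒< b d b<d)

≺⇒lexLt : ∀ p q → p ≺ q → T (lexLt p q)
≺⇒lexLt (a , b) (c , d) (inj₁ a<c)         = Equivalence.from T-∨ (inj₁ (ℕₚ.<⇒<ᵇ a<c))
≺⇒lexLt (a , b) (c , d) (inj₂ (refl , b<d)) =
  Equivalence.from (T-∨ {a <ᵇ a}) (inj₂ (Equivalence.from T-∧ (ℕₚ.≡⇒≡ᵇ a a refl , ℕₚ.<⇒<ᵇ b<d)))

≺-irrefl : ∀ {p} → ¬ (p ≺ p)
≺-irrefl (inj₁ a<a)       = ℕₚ.<-irrefl refl a<a
≺-irrefl (inj₂ (_ , b<b)) = ℕₚ.<-irrefl refl b<b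

≺-trans : ∀ {p q r} → p ≺ q → q ≺ r → p ≺ r
≺-trans (inj₁ a<b)       (inj₁ b<c)       = inj₁ (ℕₚ.<-trans a<b b<c)
≺-trans (inj₁ a<b)       (inj₂ (refl , _)) = inj₁ a<b
≺-trans (inj₂ (refl , _)) (inj₁ b<c)       = inj₁ b<c
≺-trans (inj₂ (refl , x)) (inj₂ (refl , y)) = inj₂ (refl , ℕₚ.<-trans x y)

≺-connex : ∀ p q → p ≺ q ⊎ p ≡ q ⊎ q ≺ p
≺-connex (a , b) (c , d) with ℕₚ.<-cmp a c | ℕₚ.<-cmp b d
... | tri< a<c _ _  | _              = inj₁ (inj₁ a<c)
... | tri> _ _ c<a  | _              = inj₂ (inj₂ (inj₁ c<a))
... | tri≈ _ refl _ | tri< b<d _ _   = inj₁ (inj₂ (refl , b<d))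
... | tri≈ _ refl _ | tri≈ _ refl _  = inj₂ (inj₁ refl)
... | tri≈ _ refl _ | tri> _ _ d<b   = inj₂ (inj₂ (inj₂ (refl , d<b)))

≺-maximum : ∀ p ps → ∃ λ m → m ∈ p ∷ ps × (∀ {q} → q ∈ p ∷ ps → q ≺ m ⊎ q ≡ m)
≺-maximum p [] = p , here refl , λ { (here refl) → inj₂ refl }
≺-maximum p (q ∷ ps) with m , m∈ , max ← ≺-maximum q ps with ≺-connex p m
... | inj₁ p≺m        = m , there m∈ , λ { (here refl) → inj₁ p≺m ; (there r∈) → max r∈ }
... | inj₂ (inj₁ p≡m) = m , there m∈ , λ { (here refl) → inj₂ p≡m ; (there r∈) → max r∈ }
... | inj₂ (inj₂ m≺p) = p , here refl , λ
  { (here refl) → inj₂ refl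
  ; (there r∈)  → inj₁ (case max r∈ of λ { (inj₁ r≺m) → ≺-trans r≺m m≺p ; (inj₂ refl) → m≺p }) }

dedupPairs-⊆ : ∀ bs → dedupPairs bs ⊆ bs
dedupPairs-⊆ (b ∷ bs) (here refl) = here refl
dedupPairs-⊆ (b ∷ bs) (there x∈)  = there (dedupPairs-⊆ bs (proj₁ (∈-filterᵇ⁻ _ x∈)))

dedupPairs-⊇ : ∀ bs → bs ⊆ dedupPairs bs
dedupPairs-⊇ (b ∷ bs) (here refl) = here refl
dedupPairs-⊇ (b ∷ bs) {x} (there x∈) with eqPair b x in eq
... | true  = here (sym (eqPair⇒≡ b x (subst T (sym eq) tt)))
... | false = there (∈-filterᵇ⁺ _ (dedupPairs-⊇ bs x∈) (subst (T ∘ not) (sym eq) tt))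

dedupPairs-unique : ∀ bs → Unique (dedupPairs bs)
dedupPairs-unique []       = []
dedupPairs-unique (b ∷ bs) =
  All.tabulate (λ { x∈ refl → subst (T ∘ not) (T⇒≡true (eqPair-refl b))
    (proj₂ (∈-filterᵇ⁻ (λ y → not (eqPair b y)) {xs = dedupPairs bs} x∈)) })
  ∷ filterᵇ-unique _ (dedupPairs-unique bs)

-- Lexicographic ranks of biletters, and packing

module Rank (ds : List (ℕ × ℕ)) (!ds : Unique ds) where

  below : ℕ × ℕ → List (ℕ × ℕ)
  below p = filterᵇ (λ q → lexLt q p) ds

  rank : ℕ × ℕ → ℕ
  rank p = suc (length (below p))

  ∈-below⁺ : ∀ {p q} → q ∈ ds → q ≺ p → q ∈ below p
  ∈-below⁺ {p} {q} q∈ q≺p = ∈-filterᵇ⁺ _ q∈ (≺⇒lexLt q p q≺p)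

  ∈-below⁻ : ∀ {p q} → q ∈ below p → q ∈ ds × q ≺ p
  ∈-below⁻ {p} {q} q∈ with q∈ds , t ← ∈-filterᵇ⁻ (λ q → lexLt q p) q∈ = q∈ds , lexLt⇒≺ q p t

  below-unique : ∀ p → Unique (below p)
  below-unique p = filterᵇ-unique _ !ds

  ∷below-unique : ∀ p → Unique (p ∷ below p)
  ∷below-unique p = All.tabulate (λ { x∈ refl → ≺-irrefl (proj₂ (∈-below⁻ {p} x∈)) }) ∷ below-unique p

  rank-mono : ∀ {p q} → p ∈ ds → p ≺ q → rank p < rank q
  rank-mono {p} p∈ p≺q = s≤s (Unique⊆⇒length≤ (∷below-unique p) λ
    { (here refl) → ∈-below⁺ p∈ p≺q
    ; (there r∈)  → ∈-below⁺ (proj₁ (∈-below⁻ {p} r∈)) (≺-trans (proj₂ (∈-below⁻ {p} r∈)) p≺q) })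

  rank-injective : ∀ {p q} → p ∈ ds → q ∈ ds → rank p ≡ rank q → p ≡ q
  rank-injective {p} {q} p∈ q∈ eq with ≺-connex p q
  ... | inj₁ p≺q        = ⊥-elim (ℕₚ.<⇒≢ (rank-mono p∈ p≺q) eq)
  ... | inj₂ (inj₁ p≡q) = p≡q
  ... | inj₂ (inj₂ q≺p) = ⊥-elim (ℕₚ.<⇒≢ (rank-mono q∈ q≺p) (sym eq))

  rank-cancel : ∀ {p q} → q ∈ ds → rank p < rank q → p ≺ q
  rank-cancel {p} {q} q∈ lt with ≺-connex p q
  ... | inj₁ p≺q         = p≺q
  ... | inj₂ (inj₁ refl) = ⊥-elim (ℕₚ.<-irrefl refl lt)
  ... | inj₂ (inj₂ q≺p)  = ⊥-elim (ℕₚ.<-asym lt (rank-mono q∈ q≺p))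

  -- The witness is the largest biletter m below p: the biletters below p are m and those below m,
  -- which is counted by two inclusions.
  rank-pred : ∀ {p r} → 1 ≤ r → rank p ≡ suc r → ∃ λ q → q ∈ ds × rank q ≡ r
  rank-pred {p} 1≤r eq with below p in eqb
  ... | [] = ⊥-elim (ℕₚ.<⇒≢ 1≤r (ℕₚ.suc-injective eq))
  ... | b ∷ bs with m , m∈ , max ← ≺-maximum b bs =
      m , proj₁ m∈⁻ , trans (ℕₚ.≤-antisym
        (Unique⊆⇒length≤ (∷below-unique m) (λ { (here refl) → m∈
          ; (there q∈) → subst (_ ∈_) eqb
              (∈-below⁺ (proj₁ (∈-below⁻ {m} q∈)) (≺-trans (proj₂ (∈-below⁻ {m} q∈)) (proj₂ m∈⁻))) }))
        (Unique⊆⇒length≤ (subst Unique eqb (below-unique p)) λ q∈ → case max q∈ of λ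
          { (inj₁ q≺m) → there (∈-below⁺ (proj₁ (∈-below⁻ {p} (subst (_ ∈_) (sym eqb) q∈))) q≺m)
          ; (inj₂ q≡m) → here q≡m }))
        (ℕₚ.suc-injective eq)
    where
    m∈⁻ : m ∈ ds × m ≺ p
    m∈⁻ = ∈-below⁻ {p} (subst (m ∈_) (sym eqb) m∈)

  -- Ranks have no gaps, because one can descend from p one rank at a time. This makes the packed
  -- word packed.
  rank-surjective : ∀ {p} → p ∈ ds → ∀ {a} → 1 ≤ a → a ≤ rank p → ∃ λ q → q ∈ ds × rank q ≡ a
  rank-surjective {p} p∈ {a} 1≤a a≤ = descend (rank p) p∈ refl a≤
    where
    descend : ∀ r {p} → p ∈ ds → rank p ≡ r → a ≤ r → ∃ λ q → q ∈ ds × rank q ≡ a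
    descend zero    p∈ eq a≤ = ⊥-elim (ℕₚ.<⇒≱ 1≤a a≤)
    descend (suc r) {p} p∈ eq a≤ with ℕₚ.m≤n⇒m<n∨m≡n a≤
    ... | inj₂ refl      = p , p∈ , eq
    ... | inj₁ (s≤s a≤r) with q , q∈ , eq′ ← rank-pred {p} (ℕₚ.≤-trans 1≤a a≤r) eq =
      descend r q∈ eq′ a≤r

map-proj₁-zip : ∀ (u w : Word) → length u ≡ length w → map proj₁ (zip u w) ≡ u
map-proj₁-zip []      []      eq = refl
map-proj₁-zip (a ∷ u) (b ∷ w) eq = cong (a ∷_) (map-proj₁-zip u w (ℕₚ.suc-injective eq))

map-proj₂-zip : ∀ (u w : Word) → length u ≡ length w → map proj₂ (zip u w) ≡ w
map-proj₂-zip []      []      eq = refl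
map-proj₂-zip (a ∷ u) (b ∷ w) eq = cong (b ∷_) (map-proj₂-zip u w (ℕₚ.suc-injective eq))

zip-map : ∀ (f g : ℕ → ℕ) v → zip (map f v) (map g v) ≡ map (λ a → f a , g a) v
zip-map f g []      = refl
zip-map f g (a ∷ v) = cong (_ ∷_) (zip-map f g v)

map-≡⁻ : ∀ {A B : Set} {f g : A → B} {xs} → map f xs ≡ map g xs → ∀ {x} → x ∈ xs → f x ≡ g x
map-≡⁻ {xs = x ∷ xs} eq (here refl) = Listₚ.∷-injectiveˡ eq
map-≡⁻ {xs = x ∷ xs} eq (there x∈)  = map-≡⁻ (Listₚ.∷-injectiveʳ eq) x∈

maxL-attained : ∀ {a} w → 1 ≤ a → a ≤ maxL w → ∃ λ x → x ∈ w × a ≤ x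
maxL-attained []      1≤a a≤ = ⊥-elim (ℕₚ.<⇒≱ 1≤a a≤)
maxL-attained {a} (x ∷ w) 1≤a a≤ with ℕₚ.⊔-sel x (maxL w)
... | inj₁ eq = x , here refl , subst (a ≤_) eq a≤
... | inj₂ eq with y , y∈ , a≤y ← maxL-attained w 1≤a (subst (a ≤_) eq a≤) = y , there y∈ , a≤y

module Pack (u w : Word) (lw : length u ≡ length w) where

  bs : List (ℕ × ℕ)
  bs = zip u w

  open Rank (dedupPairs bs) (dedupPairs-unique bs) public

  ∈bs⇒∈ds : bs ⊆ dedupPairs bs
  ∈bs⇒∈ds = dedupPairs-⊇ bs

  pack-packed : Packed (pack u w)
  pack-packed = positive , onto
    where
    positive : ∀ a → a ∈ pack u w → 1 ≤ a
    positive a a∈ with _ , _ , refl ← ∈-map⁻ rank a∈ = s≤s z≤n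
    onto : ∀ a → 1 ≤ a → a ≤ maxL (pack u w) → a ∈ pack u w
    onto a 1≤a a≤
      with x , x∈ , a≤x ← maxL-attained (pack u w) 1≤a a≤
      with b , b∈ , refl ← ∈-map⁻ rank x∈
      with q , q∈ , refl ← rank-surjective (∈bs⇒∈ds b∈) 1≤a a≤x
      = ∈-map⁺ rank (dedupPairs-⊆ bs q∈)

  -- φ sends a to the largest first coordinate among biletters of rank at most a, which is
  -- nondecreasing on all of ℕ. At the rank of b it returns the first coordinate of b, since a
  -- larger first coordinate means a larger rank.
  pack-finer : Finer (pack u w) u
  pack-finer = pack-packed , φ , mono , (begin
    map φ (map rank bs) ≡⟨ Listₚ.map-∘ bs ⟨
    map (φ ∘ rank) bs   ≡⟨ map-cong-∈ bs (λ _ → φ∘rank) ⟩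
    map proj₁ bs        ≡⟨ map-proj₁-zip u w lw ⟩
    u                   ∎)
    where
    open ≡-Reasoning
    atMost : ℕ → List (ℕ × ℕ)
    atMost a = filterᵇ (λ b → rank b <ᵇ suc a) bs
    φ : ℕ → ℕ
    φ a = maxL (map proj₁ (atMost a))
    ∈-φ : ∀ {a b} → b ∈ bs → rank b ≤ a → proj₁ b ≤ φ a
    ∈-φ b∈ le = ∈⇒≤maxL (∈-map⁺ proj₁ (∈-filterᵇ⁺ _ b∈ (ℕₚ.<⇒<ᵇ (s≤s le))))
    φ≤ : ∀ {a c} → (∀ {b} → b ∈ bs → rank b ≤ a → proj₁ b ≤ c) → φ a ≤ c
    φ≤ {a} bound = maxL≤ (map proj₁ (atMost a)) λ x∈ →
      let b , b∈ , x≡   = ∈-map⁻ proj₁ x∈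
          b∈bs , t = ∈-filterᵇ⁻ (λ b → rank b <ᵇ suc a) b∈
      in subst (_≤ _) (sym x≡) (bound b∈bs (ℕₚ.≤-pred (ℕₚ.<ᵇ⇒< (rank b) (suc a) t)))
    mono : ∀ a b → a ≤ b → φ a ≤ φ b
    mono a b a≤b = φ≤ λ c∈ le → ∈-φ c∈ (ℕₚ.≤-trans le a≤b)
    φ∘rank : ∀ {b} → b ∈ bs → φ (rank b) ≡ proj₁ b
    φ∘rank {b} b∈ = ℕₚ.≤-antisym
      (φ≤ λ {c} c∈ le → ℕₚ.≮⇒≥ λ lt → ℕₚ.<⇒≱ (rank-mono {b} {c} (∈bs⇒∈ds b∈) (inj₁ lt)) le)
      (∈-φ b∈ ℕₚ.≤-refl)

-- Fibres of w ↦ pack u w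

nth : Word → ℕ → ℕ
nth []      i       = 0
nth (x ∷ w) zero    = x
nth (x ∷ w) (suc i) = nth w i

-- 1-based: the letter a is sent to the a-th entry.
at : Word → ℕ → ℕ
at ψ a = nth ψ (a ∸ 1)

map-nth : ∀ w → map (nth w) (upTo (length w)) ≡ w
map-nth []      = refl
map-nth (x ∷ w) = trans (cong (map (nth (x ∷ w))) (upTo-suc (length w)))
  (cong (x ∷_) (trans (sym (Listₚ.map-∘ (upTo (length w)))) (map-nth w)))

map-at : ∀ {M} ψ → length ψ ≡ M → map (at ψ) (oneTo M) ≡ ψ
map-at ψ refl = trans (sym (Listₚ.map-∘ (upTo (length ψ)))) (map-nth ψ)

nth-applyUpTo : ∀ (f : ℕ → ℕ) n {i} → i < n → nth (applyUpTo f n) i ≡ f i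
nth-applyUpTo f (suc n) {zero}  _         = refl
nth-applyUpTo f (suc n) {suc i} (s≤s i<n) = nth-applyUpTo (f ∘ suc) n i<n

map-oneTo : {A : Set} (f : ℕ → A) (n : ℕ) → map f (oneTo n) ≡ applyUpTo (f ∘ suc) n
map-oneTo f n = trans (sym (Listₚ.map-∘ (upTo n))) (Listₚ.map-upTo (f ∘ suc) n)

at-map : ∀ f M {a} → a ∈ oneTo M → at (map f (oneTo M)) a ≡ f a
at-map f M {suc a} a∈ = trans (cong (λ w → nth w a) (map-oneTo f M))
  (nth-applyUpTo (f ∘ suc) M (proj₂ (∈-oneTo⁻ a∈)))
at-map f M {zero} a∈ = ⊥-elim (ℕₚ.<⇒≱ (proj₁ (∈-oneTo⁻ a∈)) z≤n)

-- Recovers ψ from w = ψ ∘ v. The choice of the first position is harmless: w takes the same value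
-- wherever v has the letter a.
firstAt : Word → Word → ℕ → ℕ
firstAt []      w       a = 0
firstAt (b ∷ v) []      a = 0
firstAt (b ∷ v) (x ∷ w) a = if a ≡ᵇ b then x else firstAt v w a

firstAt-∈ : ∀ v w {a} → length v ≡ length w → a ∈ v → firstAt v w a ∈ w
firstAt-∈ (b ∷ v) (x ∷ w) {a} eq a∈ with a ≡ᵇ b in eqb
firstAt-∈ (b ∷ v) (x ∷ w) {a} eq a∈          | true  = here refl
firstAt-∈ (b ∷ v) (x ∷ w) {a} eq (here refl) | false = ⊥-elim (subst T eqb (ℕₚ.≡⇒≡ᵇ a a refl))
firstAt-∈ (b ∷ v) (x ∷ w) {a} eq (there a∈)  | false = there (firstAt-∈ v w (ℕₚ.suc-injective eq) a∈)

-- Used with r the rank and s the second coordinate, it recovers the second letter of a biletter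
-- from its rank; used with r the identity, it recovers ψ.
firstAt-map : {B : Set} (r s : B → ℕ) (bs : List B) →
  ∀ {b} → (∀ {b′} → b′ ∈ bs → r b ≡ r b′ → s b′ ≡ s b) → b ∈ bs → firstAt (map r bs) (map s bs) (r b) ≡ s b
firstAt-map r s (c ∷ bs) {b} inj b∈ with r b ≡ᵇ r c in eq
firstAt-map r s (c ∷ bs) {b} inj b∈          | true  =
  inj (here refl) (ℕₚ.≡ᵇ⇒≡ (r b) (r c) (subst T (sym eq) tt))
firstAt-map r s (c ∷ bs) {b} inj (here refl) | false = ⊥-elim (subst T eq (ℕₚ.≡⇒≡ᵇ (r b) (r b) refl))
firstAt-map r s (c ∷ bs) {b} inj (there b∈)  | false = firstAt-map r s bs (inj ∘ there) b∈

cost-* : ∀ ℓ i x → cost ℓ i x ≡ i ℕ.* cost ℓ 1 x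
cost-* ℓ i x with x ≡ᵇ suc ℓ
... | true  = sym (ℕₚ.*-zeroʳ i)
... | false = sym (ℕₚ.*-identityʳ i)

module Fibre (v : Word) (packed : Packed v) (φ : ℕ → ℕ) (φ-mono : ∀ a b → a ≤ b → φ a ≤ φ b) where

  M : ℕ
  M = maxL v

  v⊆ : v ⊆ oneTo M
  v⊆ {a} a∈ = ∈-oneTo⁺ (proj₁ packed a a∈) (∈⇒≤maxL a∈)

  ⊆v : oneTo M ⊆ v
  ⊆v {a} a∈ = proj₂ packed a (proj₁ (∈-oneTo⁻ a∈)) (proj₂ (∈-oneTo⁻ a∈))

  -- As φ is nondecreasing, its fibres are intervals, so comparing neighbours detects the blocks.
  -- The last letter closes its block and gets `false`.
  tags : List ℕ → List (Bool × ℕ)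
  tags []           = []
  tags (a ∷ [])     = (false , count a v) ∷ []
  tags (a ∷ b ∷ as) = ((φ a ≡ᵇ φ b) , count a v) ∷ tags (b ∷ as)

  length-tags : ∀ as → length (tags as) ≡ length as
  length-tags []           = refl
  length-tags (a ∷ [])     = refl
  length-tags (a ∷ b ∷ as) = cong suc (length-tags (b ∷ as))

  D : List (Bool × ℕ)
  D = tags (oneTo M)

  length-D : length D ≡ M
  length-D = trans (length-tags (oneTo M)) (length-oneTo M)

  -- A single chain condition on biletters, equivalent to `Ok`: across a block boundary φ already
  -- increases and f is free, within a block f must increase strictly.
  Increasing : (ℕ → ℕ) → List ℕ → Set
  Increasing f = Linked (λ a b → (φ a , f a) ≺ (φ b , f b))

  Ok⇒Increasing : ∀ {ℓ} f {as} → Linked _<_ as → Ok ℓ (tags as) (map f as) → Increasing f as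
  Ok⇒Increasing f []        o       = []
  Ok⇒Increasing f [-]       o       = [-]
  Ok⇒Increasing f {a ∷ b ∷ _} (a<b ∷ l) (o , os) = step o ∷ Ok⇒Increasing f l os
    where
    step : Below (φ a ≡ᵇ φ b) (f a) (f b) → (φ a , f a) ≺ (φ b , f b)
    step o with φ a ≡ᵇ φ b in eq
    ... | true  = inj₂ (ℕₚ.≡ᵇ⇒≡ (φ a) (φ b) (subst T (sym eq) tt) , o)
    ... | false = inj₁ (ℕₚ.≤∧≢⇒< (φ-mono a b (ℕₚ.<⇒≤ a<b))
                    λ φa≡φb → subst T eq (ℕₚ.≡⇒≡ᵇ (φ a) (φ b) φa≡φb))

  Increasing⇒Ok : ∀ {ℓ} f {as} → Increasing f as → Ok ℓ (tags as) (map f as)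
  Increasing⇒Ok f []  = tt
  Increasing⇒Ok f [-] = tt , tt
  Increasing⇒Ok f {a ∷ b ∷ _} (a≺b ∷ l) = step a≺b , Increasing⇒Ok f l
    where
    step : (φ a , f a) ≺ (φ b , f b) → Below (φ a ≡ᵇ φ b) (f a) (f b)
    step o with φ a ≡ᵇ φ b in eq
    step o               | false = tt
    step (inj₁ φa<φb)    | true  =
      ⊥-elim (ℕₚ.<⇒≢ φa<φb (ℕₚ.≡ᵇ⇒≡ (φ a) (φ b) (subst T (sym eq) tt)))
    step (inj₂ (_ , lt)) | true  = lt

  oneTo-increasing : ∀ n → Linked _<_ (oneTo n)
  oneTo-increasing n = subst (Linked _<_) (sym (Listₚ.map-upTo suc n))
    (Linkedₚ.applyUpTo⁺₁ suc n λ _ → ℕₚ.≤-refl)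

  Increasing⇒≺ : ∀ f → Increasing f (oneTo M) →
    ∀ {a b} → a ∈ oneTo M → b ∈ oneTo M → a < b → (φ a , f a) ≺ (φ b , f b)
  Increasing⇒≺ f inc = lookup (Linkedₚ.Linked⇒AllPairs ℕₚ.<-trans (oneTo-increasing M))
      (Linkedₚ.Linked⇒AllPairs (λ {a} {b} {c} → ≺-trans {φ a , f a} {φ b , f b} {φ c , f c}) inc)
    where
    lookup : ∀ {as} → AllPairs _<_ as → AllPairs (λ a b → (φ a , f a) ≺ (φ b , f b)) as →
      ∀ {a b} → a ∈ as → b ∈ as → a < b → (φ a , f a) ≺ (φ b , f b)
    lookup (_ ∷ _)  (r ∷ _)  (here refl) (here refl) a<b = ⊥-elim (ℕₚ.<-irrefl refl a<b)
    lookup (_ ∷ _)  (r ∷ _)  (here refl) (there b∈)  a<b = All.lookup r b∈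
    lookup (lt ∷ _) (_ ∷ _)  (there a∈)  (here refl) a<b = ⊥-elim (ℕₚ.<-asym a<b (All.lookup lt a∈))
    lookup (_ ∷ ls) (_ ∷ rs) (there a∈)  (there b∈)  a<b = lookup ls rs a∈ b∈ a<b

  weight-tags : ∀ ℓ f as →
    weight ℓ (tags as) (map f as) ≡ sum (map (λ a → count a v ℕ.* cost ℓ 1 (f a)) as)
  weight-tags ℓ f []           = refl
  weight-tags ℓ f (a ∷ [])     = cong (_+ 0) (cost-* ℓ (count a v) (f a))
  weight-tags ℓ f (a ∷ b ∷ as) = cong₂ _+_ (cost-* ℓ (count a v) (f a)) (weight-tags ℓ f (b ∷ as))

  u : Word
  u = map φ v

  length-u : length u ≡ length v
  length-u = Listₚ.length-map φ v

  -- The map a ↦ (φ a, f a) enumerates the biletters in increasing order, so exactly a - 1 of them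
  -- lie below the one of a, and its rank is a.
  pack-increasing : ∀ f → Increasing f (oneTo M) → pack u (map f v) ≡ v
  pack-increasing f inc = begin
    map rank (zip u (map f v)) ≡⟨ cong (map rank) (zip-map φ f v) ⟩
    map rank (map χ v)         ≡⟨ Listₚ.map-∘ v ⟨
    map (rank ∘ χ) v           ≡⟨ map-cong-∈ v (λ a a∈ → rank-χ a∈) ⟩
    map id v                   ≡⟨ Listₚ.map-id v ⟩
    v                          ∎
    where
    open ≡-Reasoning
    χ : ℕ → ℕ × ℕ
    χ a = φ a , f a
    open Pack u (map f v) (trans length-u (sym (Listₚ.length-map f v))) using (bs; rank; below; ∈-below⁺; ∈-below⁻; below-unique; ∈bs⇒∈ds)
    χ-mono : ∀ {a b} → a ∈ oneTo M → b ∈ oneTo M → a < b → χ a ≺ χ b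
    χ-mono = Increasing⇒≺ f inc
    ∈bs⁺ : ∀ {a} → a ∈ v → χ a ∈ bs
    ∈bs⁺ a∈ = subst (χ _ ∈_) (sym (zip-map φ f v)) (∈-map⁺ χ a∈)
    ∈bs⁻ : ∀ {p} → p ∈ bs → ∃ λ a → a ∈ v × p ≡ χ a
    ∈bs⁻ p∈ = ∈-map⁻ χ (subst (_ ∈_) (zip-map φ f v) p∈)
    rank-χ : ∀ {a} → a ∈ v → rank (χ a) ≡ a
    rank-χ {zero}  a∈ = ⊥-elim (ℕₚ.<⇒≱ (proj₁ packed 0 a∈) z≤n)
    rank-χ {suc a} a∈ = cong suc (trans
        (ℕₚ.≤-antisym
          (Unique⊆⇒length≤ (below-unique (χ (suc a))) below⊆)
          (Unique⊆⇒length≤ smaller-unique ⊆below))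
        (Listₚ.length-applyUpTo (χ ∘ suc) a))
      where
      a≤M : suc a ≤ M
      a≤M = ∈⇒≤maxL a∈
      inRange : ∀ {i} → i < a → suc i ∈ oneTo M
      inRange i<a = ∈-oneTo⁺ (s≤s z≤n) (ℕₚ.≤-trans i<a (ℕₚ.<⇒≤ a≤M))
      smaller : List (ℕ × ℕ)
      smaller = applyUpTo (χ ∘ suc) a
      smaller-unique : Unique smaller
      smaller-unique = AllPairsₚ.applyUpTo⁺₁ (χ ∘ suc) a λ {i} {j} i<j j<a eq →
        ≺-irrefl {χ (suc j)} (subst (_≺ χ (suc j)) eq
          (χ-mono (inRange (ℕₚ.<-trans i<j j<a)) (inRange j<a) (s≤s i<j)))
      ⊆below : smaller ⊆ below (χ (suc a))
      ⊆below p∈ with i , i<a , refl ← ∈-applyUpTo⁻ (χ ∘ suc) p∈ =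
        ∈-below⁺ {χ (suc a)} (∈bs⇒∈ds (∈bs⁺ (⊆v (inRange i<a)))) (χ-mono (inRange i<a) (v⊆ a∈) (s≤s i<a))
      below⊆ : below (χ (suc a)) ⊆ smaller
      below⊆ p∈
        with p∈ds , p≺ ← ∈-below⁻ {χ (suc a)} p∈
        with c , c∈ , refl ← ∈bs⁻ (dedupPairs-⊆ bs p∈ds)
        with ℕₚ.<-cmp c (suc a)
      ... | tri≈ _ refl _ = ⊥-elim (≺-irrefl {χ c} p≺)
      ... | tri> _ _ a<c  = ⊥-elim (≺-irrefl {χ c} (≺-trans {χ c} p≺ (χ-mono (v⊆ a∈) (v⊆ c∈) a<c)))
      ... | tri< c<a _ _  = subst (χ c ∈_) (map-oneTo χ a)
        (∈-map⁺ χ (∈-oneTo⁺ (proj₁ packed c c∈) (ℕₚ.≤-pred c<a)))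

  profile : Word → Word
  profile w = map (firstAt v w) (oneTo M)

  -- Together with `fibre⇐` this makes ψ ↦ ψ ∘ v and `profile` inverse bijections between admissible
  -- ψ and the fibre of v.
  fibre⇒ : ∀ {ℓ ψ} → length ψ ≡ M → Ok ℓ D ψ →
    pack u (map (at ψ) v) ≡ v × ψ ≡ profile (map (at ψ) v)
  fibre⇒ {ℓ} {ψ} lψ ok =
    pack-increasing (at ψ) (Ok⇒Increasing (at ψ) (oneTo-increasing M)
      (subst (Ok ℓ D) (sym (map-at ψ lψ)) ok)) ,
    trans (sym (map-at ψ lψ)) (map-cong-∈ (oneTo M) λ a a∈ → sym (trans
      (cong (λ v′ → firstAt v′ (map (at ψ) v) a) (sym (Listₚ.map-id v)))
      (firstAt-map id (at ψ) v (λ { _ refl → refl }) (⊆v a∈))))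

  -- Here v is the word of ranks. Rank is injective on biletters, so w factors through v; it
  -- reflects the lexicographic order, so the factor increases within each block.
  fibre⇐ : ∀ {ℓ w} → length w ≡ length v → pack u w ≡ v →
    Ok ℓ D (profile w) × w ≡ map (at (profile w)) v
  fibre⇐ {ℓ} {w} lw eq = Increasing⇒Ok f (increasing (oneTo-increasing M) id) , (begin
      w                    ≡⟨ map-proj₂-zip u w luw ⟨
      map proj₂ bs         ≡⟨ map-cong-∈ bs (λ b b∈ → sym (f∘rank b∈)) ⟩
      map (f ∘ rank) bs    ≡⟨ Listₚ.map-∘ bs ⟩
      map f (map rank bs)  ≡⟨ cong (map f) eq ⟩
      map f v              ≡⟨ map-cong-∈ v (λ a a∈ → sym (at-map f M (v⊆ a∈))) ⟩
      map (at (profile w)) v ∎)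
    where
    open ≡-Reasoning
    luw : length u ≡ length w
    luw = trans length-u (sym lw)
    open Pack u w luw using (bs; rank; rank-injective; rank-cancel; ∈bs⇒∈ds)
    f : ℕ → ℕ
    f = firstAt v w
    f∘rank : ∀ {b} → b ∈ bs → f (rank b) ≡ proj₂ b
    f∘rank {b} b∈ = trans
      (cong₂ (λ v′ w′ → firstAt v′ w′ (rank b)) (sym eq) (sym (map-proj₂-zip u w luw)))
      (firstAt-map rank proj₂ bs
        (λ c∈ r≡ → cong proj₂ (sym (rank-injective (∈bs⇒∈ds b∈) (∈bs⇒∈ds c∈) r≡))) b∈)
    φ∘rank : ∀ {b} → b ∈ bs → φ (rank b) ≡ proj₁ b
    φ∘rank = map-≡⁻ (trans (Listₚ.map-∘ bs) (trans (cong (map φ) eq) (sym (map-proj₁-zip u w luw))))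
    letter : ∀ {a} → a ∈ oneTo M → ∃ λ b → b ∈ bs × a ≡ rank b
    letter a∈ = ∈-map⁻ rank (subst (_ ∈_) (sym eq) (⊆v a∈))
    increasing : ∀ {as} → Linked _<_ as → as ⊆ oneTo M → Increasing f as
    increasing []        as⊆ = []
    increasing [-]       as⊆ = [-]
    increasing (a<b ∷ l) as⊆
      with p , p∈ , refl ← letter (as⊆ (here refl))
      with q , q∈ , refl ← letter (as⊆ (there (here refl)))
      = subst₂ _≺_ (cong₂ _,_ (sym (φ∘rank p∈)) (sym (f∘rank p∈)))
          (cong₂ _,_ (sym (φ∘rank q∈)) (sym (f∘rank q∈)))
          (rank-cancel {p} {q} (∈bs⇒∈ds q∈) a<b)
        ∷ increasing l (as⊆ ∘ there)

  profile-⊆ : ∀ {A w} → length w ≡ length v → w ⊆ oneTo A → profile w ⊆ oneTo A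
  profile-⊆ {w = w} lw w⊆ x∈ with a , a∈ , refl ← ∈-map⁻ (firstAt v w) x∈ =
    w⊆ (firstAt-∈ v w (sym lw) (⊆v a∈))

  -- The bijection as an identity of indicators: [ψ = profile w][pack u w = v] equals
  -- [w = ψ ∘ v][ψ admissible], and summing over ψ collapses the left side.
  𝟙-pack : ∀ {ℓ w} → w ∈ words (suc ℓ) (length v) → 𝟙 (pack u w ≟ʷ v) ≡
    ∑ (words (suc ℓ) M) (λ ψ → 𝟙 (w ≟ʷ map (at ψ) v) *ᶻ 𝟙 (ok? ℓ D ψ))
  𝟙-pack {ℓ} {w} w∈ with lw , w⊆ ← ∈-wordsOver⁻ (oneTo (suc ℓ)) (length v) w∈ = begin
    𝟙 (pack u w ≟ʷ v)
      ≡⟨ ∑-words-δ (suc ℓ) (trans (Listₚ.length-map (firstAt v w) (oneTo M)) (length-oneTo M))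
           (profile-⊆ lw w⊆) (λ _ → 𝟙 (pack u w ≟ʷ v)) ⟨
    ∑ (words (suc ℓ) M) (λ ψ → 𝟙 (ψ ≟ʷ profile w) *ᶻ 𝟙 (pack u w ≟ʷ v))
      ≡⟨ ∑-cong (words (suc ℓ) M) (λ ψ ψ∈ → trans
           (sym (𝟙-× (ψ ≟ʷ profile w) (pack u w ≟ʷ v)))
           (trans (𝟙-cong ((ψ ≟ʷ profile w) ×-dec (pack u w ≟ʷ v))
                      ((w ≟ʷ map (at ψ) v) ×-dec ok? ℓ D ψ)
                (λ { (refl , eq) → let ok , w≡ = fibre⇐ lw eq in w≡ , ok })
                (λ { (refl , ok) → let eq , ψ≡ = fibre⇒ (proj₁ (∈-wordsOver⁻ _ M ψ∈)) ok in ψ≡ , eq }))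
             (𝟙-× (w ≟ʷ map (at ψ) v) (ok? ℓ D ψ)))) ⟩
    ∑ (words (suc ℓ) M) (λ ψ → 𝟙 (w ≟ʷ map (at ψ) v) *ᶻ 𝟙 (ok? ℓ D ψ)) ∎
    where open ≡-Reasoning

  finiteSize-at : ∀ {ℓ ψ} → length ψ ≡ M → finiteSize ℓ (map (at ψ) v) ≡ weight ℓ D ψ
  finiteSize-at {ℓ} {ψ} lψ = begin
    sum (map (cost ℓ 1) (map (at ψ) v))
      ≡⟨ cong sum (Listₚ.map-∘ v) ⟨
    sum (map (cost ℓ 1 ∘ at ψ) v)
      ≡⟨ sum-by-letter (cost ℓ 1 ∘ at ψ) (oneTo-unique M) v⊆ ⟨
    sum (map (λ a → count a v ℕ.* cost ℓ 1 (at ψ a)) (oneTo M))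
      ≡⟨ weight-tags ℓ (at ψ) (oneTo M) ⟨
    weight ℓ D (map (at ψ) (oneTo M))
      ≡⟨ cong (weight ℓ D) (map-at ψ lψ) ⟩
    weight ℓ D ψ ∎
    where open ≡-Reasoning

  map-at-⊆ : ∀ {ψ} → length ψ ≡ M → map (at ψ) v ⊆ ψ
  map-at-⊆ {ψ} lψ x∈ with a , a∈ , refl ← ∈-map⁻ (at ψ) x∈ =
    subst (_ ∈_) (map-at ψ lψ) (∈-map⁺ (at ψ) (v⊆ a∈))

  map-at-⊇ : ∀ {ψ} → length ψ ≡ M → ψ ⊆ map (at ψ) v
  map-at-⊇ {ψ} lψ x∈ with a , a∈ , refl ← ∈-map⁻ (at ψ) (subst (_ ∈_) (sym (map-at ψ lψ)) x∈) =
    ∈-map⁺ (at ψ) (⊆v a∈)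

  -- Change of variables w = ψ ∘ v. Since v is packed, w and ψ have the same letters, which
  -- preserves surjectivity; a finite value given to a is taken at |v|_a positions, which matches
  -- the weights.
  ∑-fibre : ∀ ℓ (h : ℕ → ℤ) →
    ∑ (words (suc ℓ) (length v)) (λ w →
      𝟙 (surj? ℓ w) *ᶻ (h (finiteSize ℓ w) *ᶻ 𝟙 (pack u w ≟ʷ v))) ≡
    ∑ (words (suc ℓ) M) (value ℓ D h)
  ∑-fibre ℓ h = begin
    ∑ ws (λ w → 𝟙 (surj? ℓ w) *ᶻ (h (finiteSize ℓ w) *ᶻ 𝟙 (pack u w ≟ʷ v)))
      ≡⟨ ∑-cong ws (λ w w∈ → trans
           (lemma₁ (𝟙 (surj? ℓ w)) (h (finiteSize ℓ w)) _)
           (trans (cong (F w *ᶻ_) (𝟙-pack w∈)) (sym (∑-*ˡ (F w) ψs _)))) ⟩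
    ∑ ws (λ w → ∑ ψs λ ψ → F w *ᶻ (𝟙 (w ≟ʷ map (at ψ) v) *ᶻ 𝟙 (ok? ℓ D ψ)))
      ≡⟨ ∑-swap ws ψs (λ w ψ → F w *ᶻ (𝟙 (w ≟ʷ map (at ψ) v) *ᶻ 𝟙 (ok? ℓ D ψ))) ⟩
    ∑ ψs (λ ψ → ∑ ws λ w → F w *ᶻ (𝟙 (w ≟ʷ map (at ψ) v) *ᶻ 𝟙 (ok? ℓ D ψ)))
      ≡⟨ ∑-cong ψs (λ ψ ψ∈ → byProfile ψ∈) ⟩
    ∑ ψs (value ℓ D h) ∎
    where
    open ≡-Reasoning
    ws ψs : List Word
    ws = words (suc ℓ) (length v)
    ψs = words (suc ℓ) M
    F : Word → ℤ
    F w = 𝟙 (surj? ℓ w) *ᶻ h (finiteSize ℓ w)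
    lemma₁ : ∀ a b c → a *ᶻ (b *ᶻ c) ≡ (a *ᶻ b) *ᶻ c
    lemma₁ = solve-∀
    lemma₂ : ∀ a b c → a *ᶻ (b *ᶻ c) ≡ b *ᶻ (a *ᶻ c)
    lemma₂ = solve-∀
    lemma₃ : ∀ a b c → (a *ᶻ b) *ᶻ c ≡ a *ᶻ (c *ᶻ b)
    lemma₃ = solve-∀
    byProfile : ∀ {ψ} → ψ ∈ ψs →
      ∑ ws (λ w → F w *ᶻ (𝟙 (w ≟ʷ map (at ψ) v) *ᶻ 𝟙 (ok? ℓ D ψ))) ≡ value ℓ D h ψ
    byProfile {ψ} ψ∈ with lψ , ψ⊆ ← ∈-wordsOver⁻ (oneTo (suc ℓ)) M ψ∈ = begin
      ∑ ws (λ w → F w *ᶻ (𝟙 (w ≟ʷ map (at ψ) v) *ᶻ 𝟙 (ok? ℓ D ψ)))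
        ≡⟨ ∑-cong ws (λ w _ → lemma₂ (F w) (𝟙 (w ≟ʷ map (at ψ) v)) (𝟙 (ok? ℓ D ψ))) ⟩
      ∑ ws (λ w → 𝟙 (w ≟ʷ map (at ψ) v) *ᶻ (F w *ᶻ 𝟙 (ok? ℓ D ψ)))
        ≡⟨ ∑-words-δ (suc ℓ) (Listₚ.length-map (at ψ) v) (ψ⊆ ∘ map-at-⊆ lψ)
             (λ w → F w *ᶻ 𝟙 (ok? ℓ D ψ)) ⟩
      F (map (at ψ) v) *ᶻ 𝟙 (ok? ℓ D ψ)
        ≡⟨ cong₂ (λ s e → (s *ᶻ h e) *ᶻ 𝟙 (ok? ℓ D ψ))
             (𝟙-cong (surj? ℓ (map (at ψ) v)) (surj? ℓ ψ)
               (All.map (map-at-⊆ lψ)) (All.map (map-at-⊇ lψ)))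
             (finiteSize-at lψ) ⟩
      (𝟙 (surj? ℓ ψ) *ᶻ h (weight ℓ D ψ)) *ᶻ 𝟙 (ok? ℓ D ψ)
        ≡⟨ lemma₃ (𝟙 (surj? ℓ ψ)) (h (weight ℓ D ψ)) (𝟙 (ok? ℓ D ψ)) ⟩
      value ℓ D h ψ ∎

  ∑-Theta-finer : ∀ (h : ℕ → ℤ) →
    ∑ (Theta (length v)) (evaluate h (λ w → 𝟙 (pack u w ≟ʷ v))) ≡ blockProduct D h
  ∑-Theta-finer h = begin
    ∑ (Theta (length v)) (evaluate h (λ w → 𝟙 (pack u w ≟ʷ v)))
      ≡⟨ ∑-Theta (length v) h (λ w → 𝟙 (pack u w ≟ʷ v)) ⟩
    ∑ (upTo (suc (length v))) (λ ℓ → sign ℓ *ᶻ ∑ (words (suc ℓ) (length v)) (λ w →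
      𝟙 (surj? ℓ w) *ᶻ (h (finiteSize ℓ w) *ᶻ 𝟙 (pack u w ≟ʷ v))))
      ≡⟨ ∑-cong (upTo (suc (length v))) (λ ℓ _ → cong (sign ℓ *ᶻ_) (trans (∑-fibre ℓ h)
           (cong (λ m → ∑ (words (suc ℓ) m) (value ℓ D h)) (sym length-D)))) ⟩
    signedSum D (suc (length v)) h
      -- The cut-off is large enough: v contains all of 1..M, so M is at most its length.
      ≡⟨ signedSum≡blockProduct D h (s≤s (subst (_≤ length v) (sym length-D)
           (Surj⇒≤ {M} {v} (All.tabulate ⊆v)))) ⟩
    blockProduct D h ∎
    where open ≡-Reasoning

-- The polynomial of a pair of words

-- Formal sums with repeated exponents may represent the same polynomial; the functionals do not see
-- the difference, and the coefficients are among their values.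
evalPoly : Poly → (ℕ → ℤ) → ℤ
evalPoly []            h = 0ℤ
evalPoly ((c , e) ∷ p) h = c *ᶻ h e +ᶻ evalPoly p h

polyCoeff≡evalPoly : ∀ p m → polyCoeff p m ≡ evalPoly p (λ e → ⟦ e ≡ᵇ m ⟧)
polyCoeff≡evalPoly []            m = refl
polyCoeff≡evalPoly ((c , e) ∷ p) m with e ≡ᵇ m
... | true  = cong₂ _+ᶻ_ (sym (ℤₚ.*-identityʳ c)) (polyCoeff≡evalPoly p m)
... | false = trans (polyCoeff≡evalPoly p m)
  (trans (sym (ℤₚ.+-identityˡ _)) (cong (_+ᶻ _) (sym (ℤₚ.*-zeroʳ c))))

evalPoly-++ : ∀ p q h → evalPoly (p ++ q) h ≡ evalPoly p h +ᶻ evalPoly q h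
evalPoly-++ []            q h = sym (ℤₚ.+-identityˡ _)
evalPoly-++ ((c , e) ∷ p) q h = trans (cong (c *ᶻ h e +ᶻ_) (evalPoly-++ p q h))
  (sym (ℤₚ.+-assoc (c *ᶻ h e) (evalPoly p h) (evalPoly q h)))

evalPoly-monomial : ∀ c e q h →
  evalPoly (polyMul ((c , e) ∷ []) q) h ≡ c *ᶻ evalPoly q (λ x → h (e + x))
evalPoly-monomial c e []            h = sym (ℤₚ.*-zeroʳ c)
evalPoly-monomial c e ((d , f) ∷ q) h = trans
  (cong ((c *ᶻ d) *ᶻ h (e + f) +ᶻ_) (evalPoly-monomial c e q h))
  (lemma c d (h (e + f)) (evalPoly q (λ x → h (e + x))))
  where
  lemma : ∀ c d x y → (c *ᶻ d) *ᶻ x +ᶻ c *ᶻ y ≡ c *ᶻ (d *ᶻ x +ᶻ y)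
  lemma = solve-∀

evalPoly-polyMul : ∀ c e p q h → evalPoly (polyMul ((c , e) ∷ p) q) h ≡
  c *ᶻ evalPoly q (λ x → h (e + x)) +ᶻ evalPoly (polyMul p q) h
evalPoly-polyMul c e p q h = trans (cong (λ r → evalPoly r h) split)
  (trans (evalPoly-++ (polyMul ((c , e) ∷ []) q) (polyMul p q) h)
    (cong (_+ᶻ evalPoly (polyMul p q) h) (evalPoly-monomial c e q h)))
  where
  split : polyMul ((c , e) ∷ p) q ≡ polyMul ((c , e) ∷ []) q ++ polyMul p q
  split = cong (_++ polyMul p q) (sym (Listₚ.++-identityʳ _))

-- The functional t^e ↦ h e applied to the product of the 1 − t^g.
evalProduct : List ℕ → (ℕ → ℤ) → ℤ
evalProduct []       h = h 0
evalProduct (g ∷ gs) h = evalProduct gs h +ᶻ - evalProduct gs (λ e → h (g + e))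

evalProduct-cong : ∀ gs {h h′} → (∀ e → h e ≡ h′ e) → evalProduct gs h ≡ evalProduct gs h′
evalProduct-cong []       eq = eq 0
evalProduct-cong (g ∷ gs) eq = cong₂ (λ x y → x +ᶻ - y)
  (evalProduct-cong gs eq) (evalProduct-cong gs λ e → eq (g + e))

blockProduct-cong : ∀ D {h h′} → (∀ e → h e ≡ h′ e) → blockProduct D h ≡ blockProduct D h′
blockProduct-cong []            eq = eq 0
blockProduct-cong ((b , i) ∷ D) eq = cong₂ (λ x y → ⟦ not b ⟧ *ᶻ x +ᶻ - y)
  (blockProduct-cong D eq) (blockProduct-cong D λ e → eq (i + e))

evalPoly-polyProd : ∀ (g : ℕ → ℕ) ks h →
  evalPoly (polyProd (map (λ k → (+ 1 , 0) ∷ (- (+ 1) , g k) ∷ []) ks)) h ≡ evalProduct (map g ks) h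
evalPoly-polyProd g []       h = lemma (h 0)
  where
  lemma : ∀ x → 1ℤ *ᶻ x +ᶻ 0ℤ ≡ x
  lemma = solve-∀
evalPoly-polyProd g (k ∷ ks) h = begin
  evalPoly (polyMul ((+ 1 , 0) ∷ (- (+ 1) , g k) ∷ []) q) h
    ≡⟨ evalPoly-polyMul (+ 1) 0 ((- (+ 1) , g k) ∷ []) q h ⟩
  1ℤ *ᶻ evalPoly q h +ᶻ evalPoly (polyMul ((- (+ 1) , g k) ∷ []) q) h
    ≡⟨ cong (1ℤ *ᶻ evalPoly q h +ᶻ_) (evalPoly-monomial (- (+ 1)) (g k) q h) ⟩
  1ℤ *ᶻ evalPoly q h +ᶻ (- 1ℤ) *ᶻ evalPoly q (λ e → h (g k + e))
    ≡⟨ cong₂ (λ x y → 1ℤ *ᶻ x +ᶻ (- 1ℤ) *ᶻ y)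
         (evalPoly-polyProd g ks h) (evalPoly-polyProd g ks (λ e → h (g k + e))) ⟩
  1ℤ *ᶻ evalProduct (map g ks) h +ᶻ (- 1ℤ) *ᶻ evalProduct (map g ks) (λ e → h (g k + e))
    ≡⟨ lemma (evalProduct (map g ks) h) (evalProduct (map g ks) (λ e → h (g k + e))) ⟩
  evalProduct (map g (k ∷ ks)) h ∎
  where
  open ≡-Reasoning
  q : Poly
  q = polyProd (map (λ k → (+ 1 , 0) ∷ (- (+ 1) , g k) ∷ []) ks)
  lemma : ∀ x y → 1ℤ *ᶻ x +ᶻ (- 1ℤ) *ᶻ y ≡ x +ᶻ - y
  lemma = solve-∀

-- Blocks of letters and the factors of the right-hand side

sign-+ : ∀ a b → sign (a + b) ≡ sign a *ᶻ sign b
sign-+ zero    b = sym (ℤₚ.*-identityˡ (sign b))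
sign-+ (suc a) b = trans (cong -_ (sign-+ a b)) (ℤₚ.neg-distribˡ-* (sign a) (sign b))

filterᵇ-cong : {A : Set} {p q : A → Bool} (xs : List A) → (∀ x → x ∈ xs → p x ≡ q x) →
  filterᵇ p xs ≡ filterᵇ q xs
filterᵇ-cong []       eq = refl
filterᵇ-cong (x ∷ xs) eq = cong₂ (λ b ys → if b then x ∷ ys else ys)
  (eq x (here refl)) (filterᵇ-cong xs λ y → eq y ∘ there)

filterᵇ-none : {A : Set} {p : A → Bool} (xs : List A) → (∀ {x} → x ∈ xs → ¬ T (p x)) →
  filterᵇ p xs ≡ []
filterᵇ-none []       none = refl
filterᵇ-none {p = p} (x ∷ xs) none with p x | none (here refl)
... | true  | ¬t = ⊥-elim (¬t tt)
... | false | _  = filterᵇ-none xs (none ∘ there)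

filterᵇ-all : {A : Set} {p : A → Bool} (xs : List A) → (∀ {x} → x ∈ xs → T (p x)) →
  filterᵇ p xs ≡ xs
filterᵇ-all []       all = refl
filterᵇ-all {p = p} (x ∷ xs) all with p x | all (here refl)
... | true | _ = cong (x ∷_) (filterᵇ-all xs (all ∘ there))

module _ (φ : ℕ → ℕ) where

  level : List ℕ → ℕ → List ℕ
  level as k = filterᵇ (λ a → φ a ≡ᵇ k) as

  upToLevel : List ℕ → ℕ → List ℕ
  upToLevel as p = filterᵇ (λ a → φ a <ᵇ suc p) as

  -- Since φ is nondecreasing along the list, once a letter of level p + 1 appears no lower level
  -- can follow, and the rest of the lower filter is empty.
  upToLevel-suc : ∀ p {as} → AllPairs (λ a b → φ a ≤ φ b) as →
    upToLevel as (suc p) ≡ upToLevel as p ++ level as (suc p)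
  upToLevel-suc p []                            = refl
  upToLevel-suc p {a ∷ as} (a≤ ∷ sorted) with ℕₚ.<-cmp (φ a) (suc p)
  ... | tri< lt ≢ _
    rewrite T⇒≡true (ℕₚ.<⇒<ᵇ lt) | T⇒≡true (ℕₚ.<⇒<ᵇ (ℕₚ.m<n⇒m<1+n lt))
          | ¬T⇒≡false (≢ ∘ ℕₚ.≡ᵇ⇒≡ (φ a) (suc p)) = cong (a ∷_) (upToLevel-suc p sorted)
  ... | tri≈ ≮ eq _
    rewrite ¬T⇒≡false (≮ ∘ ℕₚ.<ᵇ⇒< (φ a) (suc p)) | T⇒≡true (ℕₚ.<⇒<ᵇ (s≤s (ℕₚ.≤-reflexive eq)))
          | T⇒≡true (ℕₚ.≡⇒≡ᵇ (φ a) (suc p) eq)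
          | upToLevel-suc p sorted
          | filterᵇ-none {p = λ b → φ b <ᵇ suc p} as (λ {b} b∈ t →
              ℕₚ.<⇒≱ (ℕₚ.<ᵇ⇒< (φ b) (suc p) t) (subst (_≤ φ b) eq (All.lookup a≤ b∈))) = refl
  ... | tri> ≮ ≢ gt
    rewrite ¬T⇒≡false (≮ ∘ ℕₚ.<ᵇ⇒< (φ a) (suc p))
          | ¬T⇒≡false (λ t → ℕₚ.<⇒≱ gt (ℕₚ.≤-pred (ℕₚ.<ᵇ⇒< (φ a) (suc (suc p)) t)))
          | ¬T⇒≡false (≢ ∘ ℕₚ.≡ᵇ⇒≡ (φ a) (suc p)) = upToLevel-suc p sorted

  concat-levels : ∀ {as} → AllPairs (λ a b → φ a ≤ φ b) as → (∀ {a} → a ∈ as → 1 ≤ φ a) →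
    ∀ p → concatMap (level as) (oneTo p) ≡ upToLevel as p
  concat-levels {as} sorted pos zero = sym (filterᵇ-none as λ {a} a∈ t →
    ℕₚ.<⇒≱ (ℕₚ.<ᵇ⇒< (φ a) 1 t) (pos a∈))
  concat-levels {as} sorted pos (suc p) = begin
    concatMap (level as) (oneTo (suc p))
      ≡⟨ cong (concatMap (level as)) (oneTo-∷ʳ p) ⟩
    concatMap (level as) (oneTo p ∷ʳ suc p)
      ≡⟨ Listₚ.concatMap-++ (level as) (oneTo p) (suc p ∷ []) ⟩
    concatMap (level as) (oneTo p) ++ (level as (suc p) ++ [])
      ≡⟨ cong₂ _++_ (concat-levels sorted pos p) (Listₚ.++-identityʳ (level as (suc p))) ⟩
    upToLevel as p ++ level as (suc p)
      ≡⟨ upToLevel-suc p sorted ⟨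
    upToLevel as (suc p) ∎
    where open ≡-Reasoning

module Evaluation (v : Word) (packed : Packed v) (φ : ℕ → ℕ) (φ-mono : ∀ a b → a ≤ b → φ a ≤ φ b) where

  open Fibre v packed φ φ-mono

  mults : List ℕ → List ℕ
  mults = map (λ a → count a v)

  -- Within the block every tag but the last is `true` and yields only -t^i: together these give the
  -- sign and the translation by the sum over `initL`. The last tag is `false`, as no letter of the
  -- block follows, and yields 1 - t^g.
  blockProduct-block : ∀ {k} a B rest h → All (λ b → φ b ≡ k) (a ∷ B) → All (λ b → φ b ≢ k) rest →
    blockProduct (tags (a ∷ B ++ rest)) h ≡
    sign (length B) *ᶻ
      (blockProduct (tags rest) (λ e → h (sum (initL (mults (a ∷ B))) + e)) +ᶻ
       - blockProduct (tags rest) (λ e → h (sum (initL (mults (a ∷ B))) + (lastL (mults (a ∷ B)) + e))))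
  blockProduct-block a [] [] h _ _ = lemma (h 0) (h (count a v + 0))
    where
    lemma : ∀ x y → 1ℤ *ᶻ x +ᶻ - y ≡ 1ℤ *ᶻ (x +ᶻ - y)
    lemma = solve-∀
  blockProduct-block a [] (b ∷ rest) h (refl ∷ []) (φb≢ ∷ _)
    rewrite ¬T⇒≡false (≢-sym φb≢ ∘ ℕₚ.≡ᵇ⇒≡ (φ a) (φ b)) =
    lemma (blockProduct (tags (b ∷ rest)) h) (blockProduct (tags (b ∷ rest)) λ e → h (count a v + e))
    where
    lemma : ∀ x y → 1ℤ *ᶻ x +ᶻ - y ≡ 1ℤ *ᶻ (x +ᶻ - y)
    lemma = solve-∀
  blockProduct-block a (b ∷ B) rest h (refl ∷ φb ∷ φB) φrest
    rewrite T⇒≡true (ℕₚ.≡⇒≡ᵇ (φ a) (φ b) (sym φb)) = begin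
    0ℤ *ᶻ blockProduct (tags (b ∷ B ++ rest)) h +ᶻ - blockProduct (tags (b ∷ B ++ rest)) (λ e → h (i + e))
      ≡⟨ cong (λ x → 0ℤ *ᶻ blockProduct (tags (b ∷ B ++ rest)) h +ᶻ - x)
           (blockProduct-block b B rest (λ e → h (i + e)) (φb ∷ φB) φrest) ⟩
    0ℤ *ᶻ blockProduct (tags (b ∷ B ++ rest)) h +ᶻ - (sign (length B) *ᶻ
      (product (λ e → h (i + (s + e))) +ᶻ - product (λ e → h (i + (s + (l + e))))))
      ≡⟨ lemma (blockProduct (tags (b ∷ B ++ rest)) h) (sign (length B)) _ ⟩
    (- sign (length B)) *ᶻ (product (λ e → h (i + (s + e))) +ᶻ - product (λ e → h (i + (s + (l + e)))))
      ≡⟨ cong ((- sign (length B)) *ᶻ_) (cong₂ (λ x y → x +ᶻ - y)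
           (blockProduct-cong (tags rest) λ e → cong h (sym (ℕₚ.+-assoc i s e)))
           (blockProduct-cong (tags rest) λ e → cong h (sym (ℕₚ.+-assoc i s (l + e))))) ⟩
    (- sign (length B)) *ᶻ (product (λ e → h ((i + s) + e)) +ᶻ - product (λ e → h ((i + s) + (l + e)))) ∎
    where
    open ≡-Reasoning
    product : (ℕ → ℤ) → ℤ
    product = blockProduct (tags rest)
    i s l : ℕ
    i = count a v
    s = sum (initL (mults (b ∷ B)))
    l = lastL (mults (b ∷ B))
    lemma : ∀ x s y → 0ℤ *ᶻ x +ᶻ - (s *ᶻ y) ≡ (- s) *ᶻ y
    lemma = solve-∀

  module _ (block : ℕ → List ℕ) (block-φ : ∀ k → All (λ a → φ a ≡ k) (block k)) where

    low high : ℕ → ℕ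
    low  k = sum (initL (mults (block k)))
    high k = lastL (mults (block k))

    excess : List ℕ → ℕ
    excess ks = sum (map (λ k → length (block k) ∸ 1) ks)

    -- A nonempty block has one last letter besides those counted by `excess`. This identifies the
    -- exponent of the sign with max(v) - max(u).
    length-blocks : ∀ ks → (∀ {k} → k ∈ ks → 1 ≤ length (block k)) →
      length (concatMap block ks) ≡ excess ks + length ks
    length-blocks []       ne = refl
    length-blocks (k ∷ ks) ne
      rewrite Listₚ.length-++ (block k) {concatMap block ks} | length-blocks ks (ne ∘ there)
      with length (block k) | ne (here refl)
    ... | suc n | _ = lemma n (excess ks) (length ks)
      where
      lemma : ∀ n e l → suc n + (e + l) ≡ (n + e) + suc l
      lemma = ℕ-solve-∀

    ∈-concatMap-block : ∀ ks {a} → a ∈ concatMap block ks → φ a ∈ ks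
    ∈-concatMap-block (k ∷ ks) a∈ with ∈-++⁻ (block k) a∈
    ... | inj₁ a∈k  = here (All.lookup (block-φ k) a∈k)
    ... | inj₂ a∈ks = there (∈-concatMap-block ks a∈ks)

    -- Distinctness of the levels guarantees that a block is followed by letters of other levels, so
    -- its last tag is `false` and the product splits block by block.
    blockProduct-blocks : ∀ ks h → Unique ks → (∀ {k} → k ∈ ks → 1 ≤ length (block k)) →
      blockProduct (tags (concatMap block ks)) h ≡
      sign (excess ks) *ᶻ evalProduct (map high ks) (λ e → h (sum (map low ks) + e))
    blockProduct-blocks []       h _          ne = sym (ℤₚ.*-identityˡ (h 0))
    blockProduct-blocks (k ∷ ks) h (k∉ ∷ !ks) ne = go (block k) refl
      where
      open ≡-Reasoning
      rest : List ℕ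
      rest = concatMap block ks
      F : ℕ
      F = sum (map low ks)
      tops : (ℕ → ℤ) → ℤ
      tops = evalProduct (map high ks)
      φrest : All (λ b → φ b ≢ k) rest
      φrest = All.tabulate λ b∈ φb≡k →
        All.lookup k∉ (∈-concatMap-block ks b∈) (sym φb≡k)
      IH : ∀ h → blockProduct (tags rest) h ≡ sign (excess ks) *ᶻ tops (λ e → h (F + e))
      IH h = blockProduct-blocks ks h !ks (ne ∘ there)
      +-comm₃ : ∀ s l F e → s + (l + (F + e)) ≡ (s + F) + (l + e)
      +-comm₃ = ℕ-solve-∀
      lemma : ∀ a b x y → a *ᶻ (b *ᶻ x +ᶻ - (b *ᶻ y)) ≡ (a *ᶻ b) *ᶻ (x +ᶻ - y)
      lemma = solve-∀
      go : ∀ B → B ≡ block k → blockProduct (tags (block k ++ rest)) h ≡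
        sign (excess (k ∷ ks)) *ᶻ evalProduct (map high (k ∷ ks)) (λ e → h (low k + F + e))
      go []      eq = ⊥-elim (ℕₚ.<⇒≢ (ne (here refl)) (cong length eq))
      go (a ∷ B) eq = begin
        blockProduct (tags (block k ++ rest)) h
          ≡⟨ cong (λ C → blockProduct (tags (C ++ rest)) h) (sym eq) ⟩
        blockProduct (tags (a ∷ B ++ rest)) h
          ≡⟨ blockProduct-block a B rest h (subst (All _) (sym eq) (block-φ k)) φrest ⟩
        _
          ≡⟨ cong (λ C → sign (length C ∸ 1) *ᶻ
               (blockProduct (tags rest) (λ e → h (sum (initL (mults C)) + e)) +ᶻ
                - blockProduct (tags rest) (λ e → h (sum (initL (mults C)) + (lastL (mults C) + e))))) eq ⟩
        sign (length (block k) ∸ 1) *ᶻ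
          (blockProduct (tags rest) (λ e → h (low k + e)) +ᶻ
           - blockProduct (tags rest) (λ e → h (low k + (high k + e))))
          ≡⟨ cong₂ (λ x y → sign (length (block k) ∸ 1) *ᶻ (x +ᶻ - y)) (IH _) (IH _) ⟩
        sign (length (block k) ∸ 1) *ᶻ
          (sign (excess ks) *ᶻ tops (λ e → h (low k + (F + e))) +ᶻ
           - (sign (excess ks) *ᶻ tops (λ e → h (low k + (high k + (F + e))))))
          ≡⟨ lemma (sign (length (block k) ∸ 1)) (sign (excess ks)) _ _ ⟩
        (sign (length (block k) ∸ 1) *ᶻ sign (excess ks)) *ᶻ
          (tops (λ e → h (low k + (F + e))) +ᶻ - tops (λ e → h (low k + (high k + (F + e)))))
          ≡⟨ cong₂ _*ᶻ_ (sym (sign-+ (length (block k) ∸ 1) (excess ks))) (cong₂ (λ x y → x +ᶻ - y)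
               (evalProduct-cong (map high ks) λ e → cong h (sym (ℕₚ.+-assoc (low k) F e)))
               (evalProduct-cong (map high ks) λ e → cong h (+-comm₃ (low k) (high k) F e))) ⟩
        sign (excess (k ∷ ks)) *ᶻ evalProduct (map high (k ∷ ks)) (λ e → h (low k + F + e)) ∎

  module _ (packed-u : Packed u) where

    p : ℕ
    p = maxL u

    -- As u = φ ∘ v, the biletters of u and v are the pairs (φ a, a). The blocks defined by
    -- positions therefore do not depend on which φ witnesses the refinement.
    blockLetters≡level : ∀ k → blockLetters u v k ≡ level φ (oneTo M) k
    blockLetters≡level k = filterᵇ-cong (oneTo M) λ a a∈ → T-cong (to a) (from (⊆v a∈))
      where
      T-cong : ∀ {x y} → (T x → T y) → (T y → T x) → x ≡ y
      T-cong {true}  {true}  f g = refl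
      T-cong {true}  {false} f g = ⊥-elim (f tt)
      T-cong {false} {true}  f g = ⊥-elim (g tt)
      T-cong {false} {false} f g = refl
      any⁻ : {A : Set} (q : A → Bool) (xs : List A) → T (anyᵇ q xs) → ∃ λ x → x ∈ xs × T (q x)
      any⁻ q (x ∷ xs) t with Equivalence.to T-∨ t
      ... | inj₁ qx = x , here refl , qx
      ... | inj₂ t′ with y , y∈ , qy ← any⁻ q xs t′ = y , there y∈ , qy
      any⁺ : {A : Set} (q : A → Bool) {xs : List A} {x : A} → x ∈ xs → T (q x) → T (anyᵇ q xs)
      any⁺ q {x ∷ xs} (here refl) qx = Equivalence.from T-∨ (inj₁ qx)
      any⁺ q {x ∷ xs} (there x∈)  qx = Equivalence.from (T-∨ {q x}) (inj₂ (any⁺ q x∈ qx))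
      zip-u : zip u v ≡ map (λ a → φ a , a) v
      zip-u = trans (cong (zip u) (sym (Listₚ.map-id v))) (zip-map φ id v)
      to : ∀ a → T (anyᵇ (λ q → eqPair q (k , a)) (zip u v)) → T (φ a ≡ᵇ k)
      to a t
        with q , q∈ , eq ← any⁻ (λ q → eqPair q (k , a)) (zip u v) t
        with b , _ , refl ← ∈-map⁻ (λ a → φ a , a) (subst (q ∈_) zip-u q∈)
        with refl ← eqPair⇒≡ (φ b , b) (k , a) eq
        = ℕₚ.≡⇒≡ᵇ (φ a) (φ a) refl
      from : ∀ {a} → a ∈ v → T (φ a ≡ᵇ k) → T (anyᵇ (λ q → eqPair q (k , a)) (zip u v))
      from {a} a∈ t with refl ← ℕₚ.≡ᵇ⇒≡ (φ a) k t =
        any⁺ (λ q → eqPair q (φ a , a)) (subst ((φ a , a) ∈_) (sym zip-u) (∈-map⁺ (λ a → φ a , a) a∈))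
          (eqPair-refl (φ a , a))

    block : ℕ → List ℕ
    block = blockLetters u v

    φ∈u : ∀ {a} → a ∈ oneTo M → φ a ∈ u
    φ∈u a∈ = ∈-map⁺ φ (⊆v a∈)

    block-φ : ∀ k → All (λ a → φ a ≡ k) (block k)
    block-φ k = subst (All _) (sym (blockLetters≡level k)) (All.tabulate λ {a} a∈ →
      ℕₚ.≡ᵇ⇒≡ (φ a) k (proj₂ (∈-filterᵇ⁻ (λ a → φ a ≡ᵇ k) {xs = oneTo M} a∈)))

    block-nonempty : ∀ {k} → k ∈ oneTo p → 1 ≤ length (block k)
    block-nonempty {k} k∈
      with a , a∈ , refl ← ∈-map⁻ φ (proj₂ packed-u k (proj₁ (∈-oneTo⁻ k∈)) (proj₂ (∈-oneTo⁻ k∈)))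
      = subst (λ B → 1 ≤ length B) (sym (blockLetters≡level k))
          (∈-length (∈-filterᵇ⁺ _ (v⊆ a∈) (ℕₚ.≡⇒≡ᵇ (φ a) (φ a) refl)))

    -- Monotonicity of φ puts the blocks one after another, and positivity and the maximum of u
    -- ensure that levels 1..p exhaust the letters of v.
    concat-blocks : concatMap block (oneTo p) ≡ oneTo M
    concat-blocks = begin
      concatMap block (oneTo p)
        ≡⟨ Listₚ.concatMap-cong blockLetters≡level (oneTo p) ⟩
      concatMap (level φ (oneTo M)) (oneTo p)
        ≡⟨ concat-levels φ
             (AllPairs.map (λ {a} {b} a<b → φ-mono a b (ℕₚ.<⇒≤ a<b))
               (Linkedₚ.Linked⇒AllPairs ℕₚ.<-trans (oneTo-increasing M)))
             (λ a∈ → proj₁ packed-u _ (φ∈u a∈)) p ⟩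
      upToLevel φ (oneTo M) p
        ≡⟨ filterᵇ-all (oneTo M) (λ a∈ → ℕₚ.<⇒<ᵇ (s≤s (∈⇒≤maxL (φ∈u a∈)))) ⟩
      oneTo M ∎
      where open ≡-Reasoning

    excess≡ : excess block block-φ (oneTo p) ≡ M ∸ p
    excess≡ = begin
      excess block block-φ (oneTo p)
        ≡⟨ ℕₚ.m+n∸n≡m _ p ⟨
      (excess block block-φ (oneTo p) + p) ∸ p
        ≡⟨ cong (λ n → (excess block block-φ (oneTo p) + n) ∸ p) (sym (length-oneTo p)) ⟩
      (excess block block-φ (oneTo p) + length (oneTo p)) ∸ p
        ≡⟨ cong (_∸ p) (length-blocks block block-φ (oneTo p) block-nonempty) ⟨
      length (concatMap block (oneTo p)) ∸ p
        ≡⟨ cong (λ as → length as ∸ p) concat-blocks ⟩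
      length (oneTo M) ∸ p
        ≡⟨ cong (_∸ p) (length-oneTo M) ⟩
      M ∸ p ∎
      where open ≡-Reasoning

    evalPoly-rhsPoly : ∀ h → evalPoly (rhsPoly u v) h ≡ blockProduct D h
    evalPoly-rhsPoly h = begin
      evalPoly (rhsPoly u v) h
        ≡⟨ evalPoly-monomial (sign (M ∸ p)) (fUV u v) factors h ⟩
      sign (M ∸ p) *ᶻ evalPoly factors (λ e → h (fUV u v + e))
        ≡⟨ cong₂ _*ᶻ_ (cong sign (sym excess≡))
             (evalPoly-polyProd (gUV u v) (oneTo p) (λ e → h (fUV u v + e))) ⟩
      sign (excess block block-φ (oneTo p)) *ᶻ
        evalProduct (map (gUV u v) (oneTo p)) (λ e → h (fUV u v + e))
        ≡⟨ blockProduct-blocks block block-φ (oneTo p) h (oneTo-unique p) block-nonempty ⟨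
      blockProduct (tags (concatMap block (oneTo p))) h
        ≡⟨ cong (λ as → blockProduct (tags as) h) concat-blocks ⟩
      blockProduct D h ∎
      where
      open ≡-Reasoning
      factors : Poly
      factors = polyProd (map (λ k → (+ 1 , 0) ∷ (- (+ 1) , gUV u v k) ∷ []) (oneTo p))

-- Comparison of coefficients

theorem6p9 : (n : ℕ) (u : Word) → Packed u → length u ≡ n →
    (v : Word) (m : ℕ) →
    (Finer v u → coeff (starN u (Theta n)) v m ≡ polyCoeff (rhsPoly u v) m)
    × (¬ Finer v u → coeff (starN u (Theta n)) v m ≡ + 0)
theorem6p9 n u packed-u refl v m = finer , notFiner
  where
  open ≡-Reasoning
  h : ℕ → ℤ
  h e = ⟦ e ≡ᵇ m ⟧

  coeff-star : coeff (starN u (Theta n)) v m ≡ ∑ (Theta n) (evaluate h (λ w → 𝟙 (pack u w ≟ʷ v)))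
  coeff-star = trans (coeff≡∑ (starN u (Theta n)) v m) (∑-starN u (Theta n) v h)

  finer : Finer v u → coeff (starN u (Theta n)) v m ≡ polyCoeff (rhsPoly u v) m
  finer (packed-v , φ , φ-mono , refl) = begin
    coeff (starN u (Theta n)) v m
      ≡⟨ coeff-star ⟩
    ∑ (Theta n) (evaluate h (λ w → 𝟙 (pack u w ≟ʷ v)))
      ≡⟨ cong (λ n → ∑ (Theta n) (evaluate h (λ w → 𝟙 (pack u w ≟ʷ v)))) (Listₚ.length-map φ v) ⟩
    ∑ (Theta (length v)) (evaluate h (λ w → 𝟙 (pack u w ≟ʷ v)))
      ≡⟨ Fibre.∑-Theta-finer v packed-v φ φ-mono h ⟩
    blockProduct (Fibre.D v packed-v φ φ-mono) h
      ≡⟨ Evaluation.evalPoly-rhsPoly v packed-v φ φ-mono packed-u h ⟨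
    evalPoly (rhsPoly u v) h
      ≡⟨ polyCoeff≡evalPoly (rhsPoly u v) m ⟨
    polyCoeff (rhsPoly u v) m ∎

  notFiner : ¬ Finer v u → coeff (starN u (Theta n)) v m ≡ + 0
  notFiner ¬finer = begin
    coeff (starN u (Theta n)) v m
      ≡⟨ coeff-star ⟩
    ∑ (Theta n) (evaluate h (λ w → 𝟙 (pack u w ≟ʷ v)))
      ≡⟨ ∑-Theta n h (λ w → 𝟙 (pack u w ≟ʷ v)) ⟩
    ∑ (upTo (suc n)) (λ ℓ → sign ℓ *ᶻ ∑ (words (suc ℓ) n) (λ w →
      𝟙 (surj? ℓ w) *ᶻ (h (finiteSize ℓ w) *ᶻ 𝟙 (pack u w ≟ʷ v))))
      ≡⟨ ∑-zero (upTo (suc n)) (λ ℓ _ → trans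
           (cong (sign ℓ *ᶻ_) (∑-zero (words (suc ℓ) n) λ w w∈ → vanish ℓ w∈)) (ℤₚ.*-zeroʳ (sign ℓ))) ⟩
    + 0 ∎
    where
    vanish : ∀ ℓ {w} → w ∈ words (suc ℓ) n →
      𝟙 (surj? ℓ w) *ᶻ (h (finiteSize ℓ w) *ᶻ 𝟙 (pack u w ≟ʷ v)) ≡ 0ℤ
    vanish ℓ {w} w∈ = trans
      (cong (λ x → 𝟙 (surj? ℓ w) *ᶻ (h (finiteSize ℓ w) *ᶻ x))
        (𝟙-no (pack u w ≟ʷ v) λ { refl → ¬finer
          (Pack.pack-finer u w (sym (proj₁ (∈-wordsOver⁻ (oneTo (suc ℓ)) n w∈)))) }))
      (trans (cong (𝟙 (surj? ℓ w) *ᶻ_) (ℤₚ.*-zeroʳ (h (finiteSize ℓ w)))) (ℤₚ.*-zeroʳ (𝟙 (surj? ℓ w))))
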